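{- For all integers $n\ge2$ and $k\ge0$, the map $\Phi$ restricts to a bijection between well-labelled Motzkin paths of size $n$ with $k$ horizontal steps and labelled binary trees with $n$ leaves exactly $k$ of which are single, and the map $\Psi$ restricts to a bijection between the latter trees and matchings on $[2n-2]$ having exactly $k$ pairs $\{i,j\}$ with $i\in\{1,\ldots,n\}$ and $j\in\{n+1,\ldots,2n-2\}$.
   Context: A well-labelled path of size $n$: $(\mathbf{p},\sigma)$ with $\mathbf{p}=p_1\ldots p_{n-1}$ a word on $\{ -1,0,+1\}$, $\sigma$ a permutation of $[n]$, $p_i=-1\Rightarrow\sigma_i<\sigma_{i+1}$, $p_i=1\Rightarrow\sigma_i>\sigma_{i+1}$; Motzkin if $\sum_{i\le j}p_i\ge0$ for $j\le n-2$ and $\sum_{i\le n-1}p_i=-1$. A horizontal step is a letter $0$ of $\mathbf{p}$. A labelled binary tree of size $n$: rooted tree with $n$ leaves with distinct labels in $[n]$, unlabelled internal vertices each with exactly two unordered children. A leaf is single if its sibling is an internal vertex. A matching on $[2m]$ is a fixed-point-free involution. $\lambda_I$ is the order-preserving bijection $[|I|]\to I$; $\lambda(\tau)$ relabels the leaves of $\tau$ via $\lambda$. $\Phi$ (Motzkin paths of size $n\ge2$ to trees): $n=2$ gives a root with leaves $1,2$; for $n>2$, $p_1=0$: a root with subtrees a leaf $\sigma_1$ and $\lambda_{[n]\setminus\{\sigma_1\}}(\Phi(p_2\ldots p_{n-1},\sigma'))$ where $\sigma'_i=\lambda^{ -1}_{[n]\setminus\{\sigma_1\}}(\sigma_{i+1})$;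 for $n>2$, $p_1=1$: with $k$ least such that $\sum_{i\le k}p_i=0$, a root with subtrees $\lambda_{I'}(\Phi(\mathbf{p}',\sigma'))$, $\lambda_{I''}(\Phi(\mathbf{p}'',\sigma''))$, where $I'=\{\sigma_1,\ldots,\sigma_k\}$, $I''=\{\sigma_{k+1},\ldots,\sigma_n\}$, $p'_i=-p_{k-i}$ ($i<k$), $p''_i=p_{k+i}$ ($i<n-k$), $\sigma'_i=\lambda^{ -1}_{I'}(\sigma_{k+1-i})$, $\sigma''_i=\lambda^{ -1}_{I''}(\sigma_{k+i})$. $\Psi$ (trees of size $n$ to matchings on $[2n-2]$): label the $n-2$ internal non-root vertices: while unlabelled non-root vertices remain, among those whose two children are both labelled pick the one having the child with least label, and give it the least unused label in $[2n-2]\setminus[n]$; then $\Psi(\tau)$ pairs $i$ and $j$ whenever they label siblings. -}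

module Defs where

open import Data.Bool using (if_then_else_)
open import Data.Fin using (Fin; zero; suc; toℕ) renaming (_<_ to _<ᶠ_)
open import Data.Fin.Subset using (Subset; inside; outside; ∣_∣; ⁅_⁆; ⊤; ⋃; _-_)
open import Data.Integer using (ℤ; 0ℤ; 1ℤ; -1ℤ) renaming (_+_ to _+ℤ_; _≤_ to _≤ℤ_; _≟_ to _≟ℤ_)
open import Data.List using (List; []; _∷_; _++_; length; map; mapMaybe; foldr; foldl; filter; find; take; drop; reverse; upTo; allFin; fromMaybe)
open import Data.List.Extrema.Nat using (min)
open import Data.List.Relation.Binary.Permutation.Propositional using (_↭_)
open import Data.List.Relation.Unary.Unique.Propositional using (Unique)
open import Data.Maybe using (Maybe; just; nothing; zipWith; _<∣>_; _>>=_) renaming (map to mapᴹ)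
open import Data.Maybe.Properties using (≡-dec)
open import Data.Nat using (ℕ; zero; suc; _+_; _*_; _∸_; _≤_; _<?_; _≤?_; _≟_; _⊓_)
open import Data.Product using (_×_; _,_)
open import Data.Unit using () renaming (⊤ to Unit)
open import Data.Vec using ([]; _∷_)
open import Algebra.Definitions using (Involutive)
open import Level using (0ℓ)
open import Relation.Binary.Bundles using (Setoid)
open import Relation.Binary.PropositionalEquality using (_≡_; _≢_; refl; _→-setoid_) renaming (setoid to ≡-setoid)
open import Relation.Nullary using (does; Dec)
open import Relation.Nullary.Decidable using (_×-dec_)
import Relation.Binary.Construct.On as On

-- Throughout, [n] = {1,…,n} is represented by Fin n, so every label is shifted
-- down by one.

------------------------------------------------------------------------
-- Well-labelled paths

data Step : Set where
  down flat up : Step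

value : Step → ℤ
value down = -1ℤ
value flat = 0ℤ
value up   = 1ℤ

opposite : Step → Step
opposite down = up
opposite flat = flat
opposite up   = down

height : ℕ → List Step → ℤ
height j p = foldr _+ℤ_ 0ℤ (map value (take j p))

horizontals : List Step → ℕ
horizontals p = length (filter (λ s → value s ≟ℤ 0ℤ) p)

Allowed : ∀ {n} → Step → Fin n → Fin n → Set
Allowed down a b = a <ᶠ b
Allowed flat a b = Unit
Allowed up   a b = b <ᶠ a

-- Compatible p σ says that Allowed pᵢ σᵢ σᵢ₊₁ holds for every i, and that σ has
-- exactly one more entry than p.
data Compatible {n : ℕ} : List Step → List (Fin n) → Set where
  [_] : ∀ a → Compatible [] (a ∷ [])
  _∷_ : ∀ {s p a b σ} → Allowed s a b → Compatible p (b ∷ σ) →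
        Compatible (s ∷ p) (a ∷ b ∷ σ)

-- The permutation σ is given in one-line notation.
record IsWellLabelled (n : ℕ) (p : List Step) (σ : List (Fin n)) : Set where
  field
    length-p    : length p ≡ n ∸ 1
    permutation : σ ↭ allFin n
    compatible  : Compatible p σ

record IsMotzkin (n : ℕ) (p : List Step) : Set where
  field
    nonnegative : ∀ j → j ≤ n ∸ 2 → 0ℤ ≤ℤ height j p
    final       : height (n ∸ 1) p ≡ -1ℤ

record MotzkinPath (n k : ℕ) : Set where
  field
    steps        : List Step
    labels       : List (Fin n)
    wellLabelled : IsWellLabelled n steps labels
    motzkin      : IsMotzkin n steps
    k-horizontal : horizontals steps ≡ k

  word : List Step × List (Fin n)
  word = steps , labels

MotzkinPaths : ℕ → ℕ → Setoid 0ℓ 0ℓ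
MotzkinPaths n k = On.setoid (≡-setoid (List Step × List (Fin n))) (MotzkinPath.word {n} {k})

------------------------------------------------------------------------
-- Labelled binary trees

-- These trees are plane; the order of children is forgotten by _≅_.
data Tree (A : Set) : Set where
  leaf : A → Tree A
  node : Tree A → Tree A → Tree A

infix 4 _≅_

data _≅_ {A : Set} : Tree A → Tree A → Set where
  leaf : ∀ {a} → leaf a ≅ leaf a
  node : ∀ {l r l′ r′} → l ≅ l′ → r ≅ r′ → node l r ≅ node l′ r′
  swap : ∀ {l r l′ r′} → l ≅ r′ → r ≅ l′ → node l r ≅ node l′ r′

≅-refl : ∀ {A} {t : Tree A} → t ≅ t
≅-refl {t = leaf _}   = leaf
≅-refl {t = node _ _} = node ≅-refl ≅-refl

≅-sym : ∀ {A} {s t : Tree A} → s ≅ t → t ≅ s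
≅-sym leaf       = leaf
≅-sym (node p q) = node (≅-sym p) (≅-sym q)
≅-sym (swap p q) = swap (≅-sym q) (≅-sym p)

≅-trans : ∀ {A} {s t u : Tree A} → s ≅ t → t ≅ u → s ≅ u
≅-trans leaf       leaf         = leaf
≅-trans (node p q) (node p′ q′) = node (≅-trans p p′) (≅-trans q q′)
≅-trans (node p q) (swap p′ q′) = swap (≅-trans p p′) (≅-trans q q′)
≅-trans (swap p q) (node p′ q′) = swap (≅-trans p q′) (≅-trans q p′)
≅-trans (swap p q) (swap p′ q′) = node (≅-trans p q′) (≅-trans q p′)

≅-setoid : Set → Setoid 0ℓ 0ℓ
≅-setoid A = record
  { Carrier       = Tree A
  ; _≈_           = _≅_
  ; isEquivalence = record { refl = ≅-refl ; sym = ≅-sym ; trans = ≅-trans }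
  }

relabel : ∀ {A B} → (A → B) → Tree A → Tree B
relabel f (leaf a)   = leaf (f a)
relabel f (node l r) = node (relabel f l) (relabel f r)

leaves : ∀ {A} → Tree A → List A
leaves (leaf a)   = a ∷ []
leaves (node l r) = leaves l ++ leaves r

singlesBelow : ∀ {A} → Tree A → Tree A → ℕ
singlesBelow (leaf _)   (leaf _)   = 0
singlesBelow (leaf _)   (node _ _) = 1
singlesBelow (node _ _) (leaf _)   = 1
singlesBelow (node _ _) (node _ _) = 0

singles : ∀ {A} → Tree A → ℕ
singles (leaf _)   = 0
singles (node l r) = singlesBelow l r + (singles l + singles r)

record BinaryTree (n k : ℕ) : Set where
  field
    tree     : Tree (Fin n)
    n-leaves : length (leaves tree) ≡ n
    distinct : Unique (leaves tree)
    k-single : singles tree ≡ k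

BinaryTrees : ℕ → ℕ → Setoid 0ℓ 0ℓ
BinaryTrees n k = On.setoid (≅-setoid (Fin n)) (BinaryTree.tree {n} {k})

------------------------------------------------------------------------
-- Matchings

record IsMatching {N : ℕ} (m : Fin N → Fin N) : Set where
  field
    involutive     : Involutive _≡_ m
    fixedPointFree : ∀ i → m i ≢ i

-- A pair {i , m i} with i among the first n points and m i beyond them is
-- counted once, through i.
mixedPairs : ∀ {N} → ℕ → (Fin N → Fin N) → ℕ
mixedPairs {N} n m = length (filter (λ i → (toℕ i <? n) ×-dec (n ≤? toℕ (m i))) (allFin N))

record Matching (n k : ℕ) : Set where
  field
    mate       : Fin (2 * n ∸ 2) → Fin (2 * n ∸ 2)
    isMatching : IsMatching mate
    k-mixed : mixedPairs n mate ≡ k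

Matchings : ℕ → ℕ → Setoid 0ℓ 0ℓ
Matchings n k = On.setoid (Fin (2 * n ∸ 2) →-setoid Fin (2 * n ∸ 2)) (Matching.mate {n} {k})

------------------------------------------------------------------------
-- The map Φ

-- enum I is the order-preserving bijection λ_I, and rank I its inverse, which
-- is undefined outside I.
enum : ∀ {n} (I : Subset n) → Fin ∣ I ∣ → Fin n
enum (outside ∷ I) i       = suc (enum I i)
enum (inside  ∷ I) zero    = zero
enum (inside  ∷ I) (suc i) = suc (enum I i)

rank : ∀ {n} (I : Subset n) → Fin n → Maybe (Fin ∣ I ∣)
rank (outside ∷ I) zero    = nothing
rank (inside  ∷ I) zero    = just zero
rank (outside ∷ I) (suc x) = rank I x
rank (inside  ∷ I) (suc x) = mapᴹ suc (rank I x)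

elements : ∀ {n} → List (Fin n) → Subset n
elements σ = ⋃ (map ⁅_⁆ σ)

firstReturn : List Step → Maybe ℕ
firstReturn p = find (λ k → height k p ≟ℤ 0ℤ) (map suc (upTo (length p)))

-- The first argument bounds the depth of the recursion. Every recursive call
-- arising from a Motzkin path is at a strictly smaller size, so the size itself
-- is a large enough bound. The result is nothing only on inputs outside the
-- domain of Φ.
Φ-bounded : ℕ → ∀ n → List Step → List (Fin n) → Maybe (Tree (Fin n))
Φ-bounded zero    _ _ _ = nothing
Φ-bounded (suc b) 2 _ _ = just (node (leaf zero) (leaf (suc zero)))
Φ-bounded (suc b) (suc (suc (suc _))) (flat ∷ p) (σ₁ ∷ σ) =
  mapᴹ (λ t → node (leaf σ₁) (relabel (enum I) t))
       (Φ-bounded b ∣ I ∣ p (mapMaybe (rank I) σ))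
  where
  I = ⊤ - σ₁
Φ-bounded (suc b) n@(suc (suc (suc _))) p@(up ∷ _) σ =
  firstReturn p >>= split
  where
  split : ℕ → Maybe (Tree (Fin n))
  split k = zipWith node
    (mapᴹ (relabel (enum I′)) (Φ-bounded b ∣ I′ ∣ p′ (mapMaybe (rank I′) (reverse (take k σ)))))
    (mapᴹ (relabel (enum I″)) (Φ-bounded b ∣ I″ ∣ p″ (mapMaybe (rank I″) (drop k σ))))
    where
    I′ = elements (take k σ)
    I″ = elements (drop k σ)
    p′ = map opposite (reverse (take (k ∸ 1) p))
    p″ = drop k p
Φ-bounded _ _ _ _ = nothing

Φ : ∀ {n} → List Step × List (Fin n) → Maybe (Tree (Fin n))
Φ {n} (p , σ) = Φ-bounded n n p σ

------------------------------------------------------------------------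
-- The map Ψ

-- Trees in the course of the labelling: internal vertices may carry a label.
data Partial : Set where
  leaf : ℕ → Partial
  node : Maybe ℕ → Partial → Partial → Partial

initial : ∀ {n} → Tree (Fin n) → Partial
initial (leaf a)   = leaf (toℕ a)
initial (node l r) = node nothing (initial l) (initial r)

label : Partial → Maybe ℕ
label (leaf a)     = just a
label (node m _ _) = m

-- The least label of a child, defined exactly when the root of the given tree is
-- an unlabelled vertex with two labelled children. Labels being distinct, it
-- determines the vertex.
key : Partial → Maybe ℕ
key (node nothing l r) = zipWith _⊓_ (label l) (label r)
key _                  = nothing

keys : Partial → List ℕ
keys (leaf _)         = []
keys t@(node _ l r) = fromMaybe (key t) ++ (keys l ++ keys r)

least : List ℕ → Maybe ℕ
least []       = nothing
least (x ∷ xs) = just (min x xs)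

_≟ᴹ_ : (x y : Maybe ℕ) → Dec (x ≡ y)
_≟ᴹ_ = ≡-dec _≟_

assign : (c v : ℕ) → Partial → Partial
assign c v (leaf a)       = leaf a
assign c v t@(node m l r) =
  node (if does (key t ≟ᴹ just c) then just v else m) (assign c v l) (assign c v r)

-- One round of the labelling, in which v is the least unused label. The root is
-- never labelled.
round : Partial → ℕ → Partial
round (leaf a)         v = leaf a
round t@(node m l r) v with least (keys l ++ keys r)
... | nothing = t
... | just c  = node m (assign c v l) (assign c v r)

-- Each round labels one of the n - 2 internal non-root vertices, using in turn
-- the labels n, …, 2n - 3 (that is n + 1, …, 2n - 2 before the shift).
labelling : ∀ {n} → Tree (Fin n) → Partial
labelling {n} t = foldl round (initial t) (map (n +_) (upTo (n ∸ 2)))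

sibling : Partial → ℕ → Maybe ℕ
sibling (leaf _)     i = nothing
sibling (node _ l r) i =
  if does (label l ≟ᴹ just i) then label r else
  if does (label r ≟ᴹ just i) then label l else
  (sibling l i <∣> sibling r i)

-- Ψ t sends each label to the label of the sibling.
Ψ : ∀ {n} → Tree (Fin n) → ℕ → Maybe ℕ
Ψ t = sibling (labelling t)

{-# OPTIONS --safe #-}
-- Φ. A Motzkin path starting with an up step factors as up e down q with e an excursion
-- and q Motzkin, and up e read backwards is Motzkin too. The down step in between says
-- that the path of the left subtree starts with a smaller label than the path of the right
-- one. This fixes the order of two non-leaf subtrees, while a leaf is told from its sibling
-- by its shape, so the tree determines the path.
--
-- Ψ. A round of the labelling contracts the cherry containing the least label to a leaf
-- with the next label v. Seen from the matching, {a,b} are then the two mates, among the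
-- labels below v not yet consumed, whose minimum is least; mates among these labels exist
-- by the pigeonhole principle, because there are more of them than labels from v on. So
-- tree and matching determine each other round by round.

module Submission where

open import Defs
open import Data.Bool using (Bool; true; false; if_then_else_; not; _xor_)
open import Data.Fin using (Fin; zero; suc; toℕ; fromℕ<) renaming (_<_ to _<ᶠ_)
import Data.Fin.Properties as Fin
open import Data.Fin.Subset using (Subset; inside; outside; ∣_∣; ⁅_⁆; ⊤; _-_) renaming (_∈_ to _∈ˢ_)
open import Data.Fin.Subset.Properties using (x∈⁅x⁆; x∈⁅y⁆⇒x≡y; x∈p∪q⁻; x∈p∪q⁺; x∈p∧x≢y⇒x∈p-y; ∉⊥; ∈⊤)
open import Data.Integer using (+_; 0ℤ; 1ℤ; -1ℤ; +≤+) renaming (_+_ to _+ℤ_; _≤_ to _≤ℤ_; _≟_ to _≟ℤ_)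
import Data.Integer.Properties as ℤ
open import Data.List using (List; []; _∷_; _++_; _∷ʳ_; length; map; mapMaybe; foldl; filter; find; take; drop; reverse; applyUpTo; upTo; allFin; fromMaybe)
open import Data.List.Extrema.Nat using (min; min≤v⁺; v≤min⁺; argmin-sel)
open import Data.List.Properties
open import Data.List.Membership.Propositional using (_∈_; _∉_; lose)
open import Data.List.Membership.Propositional.Properties using (∈-∃++; ∈-allFin; ∈-map⁺; ∈-map⁻; ∈-++⁺ˡ; ∈-++⁺ʳ; ∈-++⁻; ∈-filter⁺; ∈-filter⁻)
open import Data.List.Relation.Binary.Permutation.Propositional using (_↭_; ↭-refl; ↭-reflexive; ↭-sym; ↭-trans; ↭⇒↭ₛ; prep; module PermutationReasoning)
open import Data.List.Relation.Binary.Permutation.Propositional.Properties using (∈-resp-↭; All-resp-↭; ↭-length; ++⁺; ++⁺ˡ; ++⁺ʳ; ↭-reverse; shift; drop-∷; filter-↭) renaming (++-comm to ++-comm-↭; map⁺ to map⁺-↭)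
import Data.List.Relation.Binary.Permutation.Setoid.Properties as PermSetoid
open import Data.List.Relation.Binary.Subset.Propositional using (_⊆_)
open import Data.List.Relation.Unary.All as All using (All; []; _∷_)
import Data.List.Relation.Unary.All.Properties as All
open import Data.List.Relation.Unary.AllPairs as AllPairs using ([]; _∷_)
open import Data.List.Relation.Unary.Any using (here; there)
open import Data.List.Relation.Unary.Unique.Propositional using (Unique)
open import Data.List.Relation.Unary.Unique.Propositional.Properties as Unique using (allFin⁺; Unique[x∷xs]⇒x∉xs)
open import Data.Maybe using (Maybe; just; nothing; zipWith; _>>=_; _<∣>_) renaming (map to mapᴹ)
open import Data.Maybe.Properties using (just-injective) renaming (map-∘ to mapᴹ-∘)
open import Data.Nat using (ℕ; zero; suc; _+_; _*_; _∸_; _⊓_; _≤_; _<_; _≟_; _<?_; _≤?_; z≤n; s≤s)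
open import Data.Nat.Properties hiding (_≟_; _<?_; _≤?_)
open import Data.Nat.Solver using (module +-*-Solver)
open import Data.List.Membership.DecPropositional _≟_ using (_∈?_)
open import Data.Product using (Σ-syntax; ∃-syntax; _×_; _,_; proj₁; proj₂)
open import Data.Sum using (_⊎_; inj₁; inj₂; [_,_]′)
open import Data.Unit using (tt)
open import Data.Vec using ([]; _∷_; here; there)
open import Function using (_∘_; id)
open import Function.Bundles using (Bijection)
open import Level using (0ℓ)
open import Relation.Binary.Definitions using (tri<; tri≈; tri>)
open import Relation.Binary.PropositionalEquality hiding ([_])
open import Relation.Nullary using (¬_; Dec; yes; no; does; contradiction)
open import Relation.Nullary.Decidable using (dec-true; dec-false; _×-dec_)
open import Relation.Unary using (Pred; Decidable)

open +-*-Solver using (solve; _:+_; _:=_)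

-- Neither map is analysed as a function. Φ recurses along a numerical bound through standardised
-- sublists with results in `Maybe`, and Ψ relabels a plane tree in place. Injectivity and
-- surjectivity are proved for the relations `Codes` and `Greedy`, which know no bounds,
-- standardisations or partial labels; `Φ-correct` and `greedy-sibling` tie the functions to them.
--
-- The obstacle for Ψ is that a contraction forgets vertices which the labelling keeps. `GraftP`
-- compares the two pictures and survives all later rounds.
--
-- The parameter k follows the same inductions. A `flat` step creates one leaf whose sibling is
-- internal. A contracted cherry gets a label not among the first n, so every leaf of a contracted
-- tree shows by its label whether it was a leaf of the original tree, and the mixed pairs are the
-- single leaves with their siblings.

private variable
  A : Set

-- Duplicate-free lists, counting, and cutting lists

Unique-resp-↭ : {xs ys : List A} → xs ↭ ys → Unique xs → Unique ys
Unique-resp-↭ p = PermSetoid.Unique-resp-↭ (setoid _) (↭⇒↭ₛ p)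

∈⇒↭ : {x : A} {xs : List A} → x ∈ xs → ∃[ ys ] xs ↭ x ∷ ys
∈⇒↭ x∈xs with ys , zs , refl ← ∈-∃++ x∈xs = ys ++ zs , shift _ ys zs

-- Each entry of `xs` can be taken out of `ys` in turn, since it does not recur in `xs`. Comparing
-- lengths then yields the pigeonhole principle, and equal lengths force an empty remainder `zs`.
Unique-⊆⇒↭ : {xs ys : List A} → Unique xs → xs ⊆ ys → ∃[ zs ] ys ↭ xs ++ zs
Unique-⊆⇒↭ {ys = ys} [] _ = ys , ↭-refl
Unique-⊆⇒↭ {xs = x ∷ xs} {ys} u@(_ ∷ u′) x∷xs⊆ys
  with ys′ , p ← ∈⇒↭ (x∷xs⊆ys (here refl)) =
  let zs , q = Unique-⊆⇒↭ u′ xs⊆ys′ in zs , ↭-trans p (prep x q)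
  where
  xs⊆ys′ : xs ⊆ ys′
  xs⊆ys′ y∈xs with ∈-resp-↭ p (x∷xs⊆ys (there y∈xs))
  ... | here refl   = contradiction y∈xs (Unique[x∷xs]⇒x∉xs u)
  ... | there y∈ys′ = y∈ys′

Unique-⊆⇒length≤ : {xs ys : List A} → Unique xs → xs ⊆ ys → length xs ≤ length ys
Unique-⊆⇒length≤ {xs = xs} {ys} u s with zs , p ← Unique-⊆⇒↭ u s = begin
  length xs               ≤⟨ m≤m+n _ _ ⟩
  length xs + length zs   ≡⟨ length-++ xs ⟨
  length (xs ++ zs)       ≡⟨ ↭-length p ⟨
  length ys               ∎
  where open ≤-Reasoning

Unique-⊆-length⇒↭ : {xs ys : List A} → Unique xs → xs ⊆ ys → length xs ≡ length ys → xs ↭ ys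
Unique-⊆-length⇒↭ {xs = xs} {ys} u s eq with Unique-⊆⇒↭ u s
... | [] , p = ↭-sym (subst (ys ↭_) (++-identityʳ xs) p)
... | z ∷ zs , p = contradiction (trans eq (trans (↭-length p) (length-++ xs)))
                     (m≢1+m+n _ ∘ (λ e → trans e (+-suc _ _)))

Unique⇒↭allFin : ∀ {n} {xs : List (Fin n)} → Unique xs → length xs ≡ n → xs ↭ allFin n
Unique⇒↭allFin {n} u eq =
  Unique-⊆-length⇒↭ u (λ _ → ∈-allFin _) (trans eq (sym (length-tabulate {n = n} _)))

Unique-++⁻ : ∀ (xs : List A) {ys} → Unique (xs ++ ys) →
             Unique xs × Unique ys × (∀ {x} → x ∈ xs → x ∉ ys)
Unique-++⁻ []       u = [] , u , λ ()
Unique-++⁻ (x ∷ xs) (x≢ ∷ u) with ux , uy , disj ← Unique-++⁻ xs u | x≢xs , x≢ys ← All.++⁻ xs x≢ =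
  x≢xs ∷ ux , uy , λ where
    (here refl) x∈ys → All.lookup x≢ys x∈ys refl
    (there x∈xs)     → disj x∈xs

find-applyUpTo : {P : Pred A 0ℓ} (P? : Decidable P) (f : ℕ → A) {k n : ℕ} → k < n →
                 (∀ {j} → j < k → ¬ P (f j)) → P (f k) → find P? (applyUpTo f n) ≡ just (f k)
find-applyUpTo P? f {zero} {suc n} _ _ Pk with P? (f 0)
... | yes _  = refl
... | no ¬P0 = contradiction Pk ¬P0
find-applyUpTo P? f {suc k} {suc n} (s≤s k<n) ¬P Pk with P? (f 0)
... | yes P0 = contradiction P0 (¬P (s≤s z≤n))
... | no _   = find-applyUpTo P? (f ∘ suc) k<n (¬P ∘ s≤s) Pk

++-injective : {A : Set} (xs ys : List A) {zs ws : List A} → length xs ≡ length ys →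
            xs ++ zs ≡ ys ++ ws → xs ≡ ys × zs ≡ ws
++-injective []       []       _  eq = refl , eq
++-injective (x ∷ xs) (y ∷ ys) le eq
  with refl , eq′ ← ∷-injective eq
  with refl , refl ← ++-injective xs ys (suc-injective le) eq′ = refl , refl

take-++ : {A : Set} (xs : List A) {ys : List A} → ∀ {k} → length xs ≡ k → take k (xs ++ ys) ≡ xs
take-++ []       refl = refl
take-++ (x ∷ xs) refl = cong (x ∷_) (take-++ xs refl)

drop-++ : {A : Set} (xs : List A) {ys : List A} → ∀ {k} → length xs ≡ k → drop k (xs ++ ys) ≡ ys
drop-++ []       refl = refl
drop-++ (x ∷ xs) refl = drop-++ xs refl

-- Invariants of trees under exchange of children

≅⇒leaves↭ : {A : Set} {s t : Tree A} → s ≅ t → leaves s ↭ leaves t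
≅⇒leaves↭ leaf       = ↭-refl
≅⇒leaves↭ (node p q) = ++⁺ (≅⇒leaves↭ p) (≅⇒leaves↭ q)
≅⇒leaves↭ (swap {l} {r} p q) = ↭-trans (++-comm-↭ (leaves l) (leaves r)) (++⁺ (≅⇒leaves↭ q) (≅⇒leaves↭ p))

singlesBelow-comm : {A : Set} (l r : Tree A) → singlesBelow l r ≡ singlesBelow r l
singlesBelow-comm (leaf _)   (leaf _)   = refl
singlesBelow-comm (leaf _)   (node _ _) = refl
singlesBelow-comm (node _ _) (leaf _)   = refl
singlesBelow-comm (node _ _) (node _ _) = refl

singlesBelow-≅ : {A : Set} {l r l′ r′ : Tree A} → l ≅ l′ → r ≅ r′ → singlesBelow l r ≡ singlesBelow l′ r′
singlesBelow-≅ leaf       leaf       = refl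
singlesBelow-≅ leaf       (node _ _) = refl
singlesBelow-≅ leaf       (swap _ _) = refl
singlesBelow-≅ (node _ _) leaf       = refl
singlesBelow-≅ (node _ _) (node _ _) = refl
singlesBelow-≅ (node _ _) (swap _ _) = refl
singlesBelow-≅ (swap _ _) leaf       = refl
singlesBelow-≅ (swap _ _) (node _ _) = refl
singlesBelow-≅ (swap _ _) (swap _ _) = refl

≅⇒singles≡ : {A : Set} {s t : Tree A} → s ≅ t → singles s ≡ singles t
≅⇒singles≡ leaf       = refl
≅⇒singles≡ (node p q) = cong₂ _+_ (singlesBelow-≅ p q) (cong₂ _+_ (≅⇒singles≡ p) (≅⇒singles≡ q))
≅⇒singles≡ (swap {l′ = l′} {r′} p q) = cong₂ _+_
  (trans (singlesBelow-≅ p q) (singlesBelow-comm r′ l′))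
  (trans (cong₂ _+_ (≅⇒singles≡ p) (≅⇒singles≡ q)) (+-comm (singles r′) (singles l′)))

-- Motzkin paths and the map Φ

module Φ-bijective where

  private variable
    a b c h m n : ℕ
    p q e : List Step
    σ τ : List (Fin n)
    l r t t′ : Tree (Fin n)
    x y : Fin n

  -- Excursions and paths read backwards

  -- Heights are natural numbers, so a step below 0 cannot be expressed and the inequalities of
  -- `IsMotzkin` disappear into the type.
  data Excursion : ℕ → List Step → ℕ → Set where
    []   : Excursion a [] a
    down : Excursion a p b → Excursion (suc a) (down ∷ p) b
    flat : Excursion a p b → Excursion a (flat ∷ p) b
    up   : Excursion (suc a) p b → Excursion a (up ∷ p) b

  infixr 5 _++ᵉ_

  _++ᵉ_ : Excursion a p b → Excursion b q c → Excursion a (p ++ q) c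
  []     ++ᵉ y = y
  down x ++ᵉ y = down (x ++ᵉ y)
  flat x ++ᵉ y = flat (x ++ᵉ y)
  up x   ++ᵉ y = up (x ++ᵉ y)

  raise : Excursion a p b → Excursion (suc a) p (suc b)
  raise []       = []
  raise (down x) = down (raise x)
  raise (flat x) = flat (raise x)
  raise (up x)   = up (raise x)

  backwards : List Step → List Step
  backwards p = map opposite (reverse p)

  backwards-∷ : ∀ s p → backwards (s ∷ p) ≡ backwards p ∷ʳ opposite s
  backwards-∷ s p = trans (cong (map opposite) (unfold-reverse s p)) (map-++ opposite (reverse p) _)

  backwards-∷ʳ : ∀ p s → backwards (p ∷ʳ s) ≡ opposite s ∷ backwards p
  backwards-∷ʳ p s = cong (map opposite) (reverse-++ p (s ∷ []))

  backwards-involutive : ∀ p → backwards (backwards p) ≡ p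
  backwards-involutive []      = refl
  backwards-involutive (s ∷ p) = begin
    backwards (backwards (s ∷ p))             ≡⟨ cong backwards (backwards-∷ s p) ⟩
    backwards (backwards p ∷ʳ opposite s)     ≡⟨ backwards-∷ʳ (backwards p) _ ⟩
    opposite (opposite s) ∷ backwards (backwards p)
      ≡⟨ cong₂ _∷_ (opposite-involutive s) (backwards-involutive p) ⟩
    s ∷ p                                     ∎
    where
    open ≡-Reasoning
    opposite-involutive : ∀ s → opposite (opposite s) ≡ s
    opposite-involutive down = refl
    opposite-involutive flat = refl
    opposite-involutive up   = refl

  -- The reversed path visits the same heights, so it stays nonnegative too.
  backwards-excursion : Excursion a p b → Excursion b (backwards p) a
  backwards-excursion [] = []
  backwards-excursion {p = s ∷ p} (down x) =
    subst (λ q → Excursion _ q _) (sym (backwards-∷ s p)) (backwards-excursion x ++ᵉ up [])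
  backwards-excursion {p = s ∷ p} (flat x) =
    subst (λ q → Excursion _ q _) (sym (backwards-∷ s p)) (backwards-excursion x ++ᵉ flat [])
  backwards-excursion {p = s ∷ p} (up x) =
    subst (λ q → Excursion _ q _) (sym (backwards-∷ s p)) (backwards-excursion x ++ᵉ down [])

  -- Decomposition of Motzkin paths at the first return

  data Motzkin : List Step → Set where
    motzkin : Excursion 0 e 0 → Motzkin (e ∷ʳ down)

  -- `h` is the height above the level `suc a`, and the cut is made where the path leaves that level
  -- downwards. A general `h` serves the induction; the use has `h = 0` and `a = 0`.
  firstDescent : ∀ h → Excursion (h + suc a) p 0 →
                 ∃[ e ] ∃[ q ] p ≡ e ++ down ∷ q × Excursion h e 0 × Excursion a q 0
  firstDescent zero    (down x) = [] , _ , refl , [] , x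
  firstDescent (suc h) (down x) with e , q , refl , y , z ← firstDescent h x =
    down ∷ e , q , refl , down y , z
  firstDescent zero    (flat x) with e , q , refl , y , z ← firstDescent 0 x =
    flat ∷ e , q , refl , flat y , z
  firstDescent (suc h) (flat x) with e , q , refl , y , z ← firstDescent (suc h) x =
    flat ∷ e , q , refl , flat y , z
  firstDescent zero    (up x) with e , q , refl , y , z ← firstDescent 1 x =
    up ∷ e , q , refl , up y , z
  firstDescent (suc h) (up x) with e , q , refl , y , z ← firstDescent (suc (suc h)) x =
    up ∷ e , q , refl , up y , z

  -- After `e` the path is at height 0, where an excursion cannot continue with `down`; so neither
  -- of `e`, `e′` extends beyond the other.
  firstDescent-unique : ∀ {e e′ q q′} → Excursion h e 0 → Excursion h e′ 0 →
                        e ++ down ∷ q ≡ e′ ++ down ∷ q′ → e ≡ e′ × q ≡ q′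
  firstDescent-unique []       []       refl = refl , refl
  firstDescent-unique (down x) (down y) eq with refl , refl ← firstDescent-unique x y (∷-injectiveʳ eq) = refl , refl
  firstDescent-unique (flat x) (flat y) eq with refl , refl ← firstDescent-unique x y (∷-injectiveʳ eq) = refl , refl
  firstDescent-unique (up x)   (up y)   eq with refl , refl ← firstDescent-unique x y (∷-injectiveʳ eq) = refl , refl
  firstDescent-unique []       (flat y) ()
  firstDescent-unique []       (up y)   ()

  -- One constructor for each clause of Φ. The `down` after the parentheses in `arch` is the first
  -- return to height 0 and belongs to neither subtree.
  data MotzkinView : List Step → Set where
    end  : MotzkinView (down ∷ [])
    flat : Motzkin p → MotzkinView (flat ∷ p)
    arch : Excursion 0 e 0 → Motzkin q → MotzkinView ((up ∷ e) ++ down ∷ q)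

  motzkinView : Motzkin p → MotzkinView p
  motzkinView (motzkin [])       = end
  motzkinView (motzkin (flat x)) = flat (motzkin x)
  motzkinView (motzkin (up x)) with e , q , refl , y , z ← firstDescent 0 x =
    subst MotzkinView (cong (up ∷_) (sym (++-assoc e (down ∷ q) _))) (arch y (motzkin z))

  backwards-arch : Excursion 0 e 0 → Motzkin (backwards (up ∷ e))
  backwards-arch {e} x = subst Motzkin (sym (backwards-∷ up e)) (motzkin (backwards-excursion x))

  arch-motzkin : Excursion 0 e 0 → Motzkin q → Motzkin ((up ∷ e) ++ down ∷ q)
  arch-motzkin {e} x (motzkin y) =
    subst Motzkin (cong (up ∷_) (++-assoc e (down ∷ _) _)) (motzkin (up (raise x ++ᵉ down y)))

  -- Heights: agreement with `IsMotzkin` and `firstReturn`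

  height-up : ∀ h j p → + h +ℤ height (suc j) (up ∷ p) ≡ + suc h +ℤ height j p
  height-up h j p = trans (sym (ℤ.+-assoc (+ h) 1ℤ (height j p))) (cong (λ m → + m +ℤ height j p) (+-comm h 1))

  height-flat : ∀ h j p → + h +ℤ height (suc j) (flat ∷ p) ≡ + h +ℤ height j p
  height-flat h j p = cong (+ h +ℤ_) (ℤ.+-identityˡ (height j p))

  height-down : ∀ h j p → + suc h +ℤ height (suc j) (down ∷ p) ≡ + h +ℤ height j p
  height-down h j p = sym (ℤ.+-assoc (+ suc h) -1ℤ (height j p))

  -- Nonnegativity takes the form of an equation with `+ c` because adding `1ℤ` then computes to
  -- `+ suc c`, visibly nonzero, as `firstReturn-arch` needs.
  height-prefix : Excursion a e b → ∀ r {j} → j ≤ length e → ∃[ c ] + a +ℤ height j (e ++ r) ≡ + c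
  height-prefix {a = a} _ r {zero} _ = a , ℤ.+-identityʳ (+ a)
  height-prefix {a = suc a} {_ ∷ e} (down x) r {suc j} (s≤s j≤)
    with c , eq ← height-prefix x r j≤ =
    c , trans (height-down a j (e ++ r)) eq
  height-prefix {a = a} {_ ∷ e} (flat x) r {suc j} (s≤s j≤)
    with c , eq ← height-prefix x r j≤ =
    c , trans (height-flat a j (e ++ r)) eq
  height-prefix {a = a} {_ ∷ e} (up x)   r {suc j} (s≤s j≤)
    with c , eq ← height-prefix x r j≤ =
    c , trans (height-up a j (e ++ r)) eq

  height-beyond : Excursion a e b → ∀ r j → + a +ℤ height (length e + j) (e ++ r) ≡ + b +ℤ height j r
  height-beyond []       r j = refl
  height-beyond {a = suc a} {_ ∷ e} (down x) r j = trans (height-down a (length e + j) (e ++ r)) (height-beyond x r j)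
  height-beyond {a = a} {_ ∷ e} (flat x) r j = trans (height-flat a (length e + j) (e ++ r)) (height-beyond x r j)
  height-beyond {a = a} {_ ∷ e} (up x)   r j = trans (height-up a (length e + j) (e ++ r)) (height-beyond x r j)

  -- Until the end of `e` the height is one more than that of an excursion, so the `down` at
  -- position `length e + 2` is the first step to reach 0.
  firstReturn-arch : Excursion 0 e 0 → ∀ q → firstReturn ((up ∷ e) ++ down ∷ q) ≡ just (suc (suc (length e)))
  firstReturn-arch {e} x q = trans
    (cong (find (λ k → height k w ≟ℤ 0ℤ)) (map-upTo suc (length w)))
    (find-applyUpTo (λ k → height k w ≟ℤ 0ℤ) suc bound before at)
    where
    w = (up ∷ e) ++ down ∷ q
    bound : suc (length e) < length w
    bound = s≤s (subst (length e <_) (sym (length-++ e)) (m<m+n (length e) (s≤s z≤n)))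
    before : ∀ {j} → j < suc (length e) → height (suc j) w ≢ 0ℤ
    before {j} (s≤s j≤) eq with c , eq′ ← height-prefix x (down ∷ q) j≤
      with () ← trans (sym (cong (1ℤ +ℤ_) (trans (sym (ℤ.+-identityˡ (height j (e ++ down ∷ q)))) eq′))) eq
    at : height (suc (suc (length e))) w ≡ 0ℤ
    at = cong (1ℤ +ℤ_) (begin
      height (suc (length e)) (e ++ down ∷ q)      ≡⟨ cong (λ k → height k (e ++ down ∷ q)) (+-comm (length e) 1) ⟨
      height (length e + 1) (e ++ down ∷ q)        ≡⟨ ℤ.+-identityˡ _ ⟨
      0ℤ +ℤ height (length e + 1) (e ++ down ∷ q)  ≡⟨ height-beyond x (down ∷ q) 1 ⟩
      -1ℤ                                          ∎)
      where open ≡-Reasoning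

  motzkin⇒IsMotzkin : Motzkin p → length p ≡ n ∸ 1 → IsMotzkin n p
  motzkin⇒IsMotzkin {n = n} (motzkin {e} x) len = record
    { nonnegative = λ j j≤ → let c , eq = height-prefix x (down ∷ []) (subst (j ≤_) n∸2≡ j≤) in
        subst (0ℤ ≤ℤ_) (sym (trans (sym (ℤ.+-identityˡ _)) eq)) (+≤+ z≤n)
    ; final = trans (cong (λ k → height k (e ∷ʳ down)) (trans (sym len) (length-++ e)))
        (trans (sym (ℤ.+-identityˡ _)) (height-beyond x (down ∷ []) 1))
    }
    where
    n∸2≡ : n ∸ 2 ≡ length e
    n∸2≡ = trans (sym (∸-+-assoc n 1 1)) (cong (_∸ 1) (trans (sym len) (trans (length-++ e) (+-comm _ 1))))

  -- Only the last of the `suc m` steps may lead below 0, so those before it form the excursion, and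
  -- the end at `-1ℤ` makes the last one a `down` from height 0. The starting height `h` varies in
  -- the induction.
  bounded⇒excursion : ∀ h m p → length p ≡ suc m → (∀ j → j ≤ m → 0ℤ ≤ℤ + h +ℤ height j p) →
                      + h +ℤ height (suc m) p ≡ -1ℤ → ∃[ e ] p ≡ e ∷ʳ down × Excursion h e 0
  bounded⇒excursion zero    zero (down ∷ []) _ _ _ = [] , refl , []
  bounded⇒excursion (suc h) zero (down ∷ []) _ _ eq with () ← trans (sym (height-down h 0 [])) eq
  bounded⇒excursion h       zero (flat ∷ []) _ _ eq with () ← trans (sym (height-flat h 0 [])) eq
  bounded⇒excursion h       zero (up ∷ [])   _ _ eq with () ← trans (sym (height-up h 0 [])) eq
  bounded⇒excursion zero (suc m) (down ∷ p) _ ≥0 _ with () ← ≥0 1 (s≤s z≤n)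
  bounded⇒excursion (suc h) (suc m) (down ∷ p) len ≥0 eq
    with e , refl , x ← bounded⇒excursion h m p (suc-injective len)
           (λ j j≤m → subst (0ℤ ≤ℤ_) (height-down h j p) (≥0 (suc j) (s≤s j≤m)))
           (trans (sym (height-down h (suc m) p)) eq) =
    down ∷ e , refl , down x
  bounded⇒excursion h (suc m) (flat ∷ p) len ≥0 eq
    with e , refl , x ← bounded⇒excursion h m p (suc-injective len)
           (λ j j≤m → subst (0ℤ ≤ℤ_) (height-flat h j p) (≥0 (suc j) (s≤s j≤m)))
           (trans (sym (height-flat h (suc m) p)) eq) =
    flat ∷ e , refl , flat x
  bounded⇒excursion h (suc m) (up ∷ p) len ≥0 eq
    with e , refl , x ← bounded⇒excursion (suc h) m p (suc-injective len)
           (λ j j≤m → subst (0ℤ ≤ℤ_) (height-up h j p) (≥0 (suc j) (s≤s j≤m)))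
           (trans (sym (height-up h (suc m) p)) eq) =
    up ∷ e , refl , up x

  IsMotzkin⇒motzkin : 2 ≤ n → length p ≡ n ∸ 1 → IsMotzkin n p → Motzkin p
  IsMotzkin⇒motzkin {suc (suc m)} {p} (s≤s (s≤s _)) len isM
    with e , refl , x ← bounded⇒excursion 0 m p len
           (λ j j≤m → subst (0ℤ ≤ℤ_) (sym (ℤ.+-identityˡ _)) (IsMotzkin.nonnegative isM j j≤m))
           (trans (ℤ.+-identityˡ _) (IsMotzkin.final isM)) = motzkin x

  -- Horizontal steps

  horizontals-++ : ∀ p q → horizontals (p ++ q) ≡ horizontals p + horizontals q
  horizontals-++ p q = trans (cong length (filter-++ _ p q)) (length-++ (filter _ p))

  horizontals-backwards : ∀ p → horizontals (backwards p) ≡ horizontals p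
  horizontals-backwards []      = refl
  horizontals-backwards (s ∷ p) = begin
    horizontals (backwards (s ∷ p))                            ≡⟨ cong horizontals (backwards-∷ s p) ⟩
    horizontals (backwards p ∷ʳ opposite s)                    ≡⟨ horizontals-++ (backwards p) _ ⟩
    horizontals (backwards p) + horizontals (opposite s ∷ [])  ≡⟨ cong₂ _+_ (horizontals-backwards p) (lemma s) ⟩
    horizontals p + horizontals (s ∷ [])                       ≡⟨ +-comm (horizontals p) _ ⟩
    horizontals (s ∷ []) + horizontals p                       ≡⟨ horizontals-++ (s ∷ []) p ⟨
    horizontals (s ∷ p)                                        ∎
    where
    open ≡-Reasoning
    lemma : ∀ s → horizontals (opposite s ∷ []) ≡ horizontals (s ∷ [])
    lemma down = refl
    lemma flat = refl
    lemma up   = refl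

  -- Labels on both sides of a cut

  infix 4 _⊲_

  -- The condition that a `down` step imposes where two blocks of labels meet: the last label on the
  -- left is smaller than the first on the right.
  data _⊲_ {n : ℕ} : List (Fin n) → List (Fin n) → Set where
    [_] : ∀ {x y τ} → x <ᶠ y → x ∷ [] ⊲ y ∷ τ
    _∷_ : ∀ x {σ τ} → σ ⊲ τ → x ∷ σ ⊲ τ

  ⊲-reverse : ∀ {x y} ρ (σ τ : List (Fin n)) → σ ≡ reverse ρ ∷ʳ x → x <ᶠ y → σ ⊲ y ∷ τ
  ⊲-reverse ρ _ τ refl x<y = go (reverse ρ)
    where
    go : ∀ ρ → ρ ∷ʳ _ ⊲ _ ∷ τ
    go []      = [ x<y ]
    go (z ∷ ρ) = z ∷ go ρ

  -- The code of a left subtree carries `reverse σ`, so the last label of `σ` comes first there, and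
  -- `_⊲_` compares the first labels of two codes.
  ⊲-heads : {σ τ : List (Fin n)} → σ ⊲ τ → ∃[ x ] ∃[ y ] ∃[ σ′ ] ∃[ τ′ ] reverse σ ≡ x ∷ σ′ × τ ≡ y ∷ τ′ × x <ᶠ y
  ⊲-heads [ x<y ]   = _ , _ , _ , _ , refl , refl , x<y
  ⊲-heads {σ = z ∷ σ} (z ∷ σ⊲τ) with x , y , σ′ , τ′ , eq , refl , x<y ← ⊲-heads σ⊲τ =
    x , y , σ′ ∷ʳ z , τ′ , trans (unfold-reverse z σ) (cong (_∷ʳ z) eq) , refl , x<y

  compatible-split : ∀ p {q} {σ : List (Fin n)} → Compatible (p ++ down ∷ q) σ →
                     ∃[ σ′ ] ∃[ σ″ ] σ ≡ σ′ ++ σ″ × Compatible p σ′ × Compatible q σ″ × σ′ ⊲ σ″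
  compatible-split []      (_∷_ {a = a} x<y c) = a ∷ [] , _ , refl , [ a ] , c , [ x<y ]
  compatible-split (s ∷ p) (_∷_ {a = a} ok c) with compatible-split p c
  ... | _ , _ , refl , [ b ] , c″ , lt = _ , _ , refl , ok ∷ [ b ] , c″ , a ∷ lt
  ... | _ , _ , refl , ok′ ∷ c′ , c″ , lt = _ , _ , refl , ok ∷ (ok′ ∷ c′) , c″ , a ∷ lt

  compatible-join : {σ τ : List (Fin n)} → Compatible p σ → Compatible q τ → σ ⊲ τ → Compatible (p ++ down ∷ q) (σ ++ τ)
  compatible-join [ x ] [ y ]  [ x<y ] = x<y ∷ [ y ]
  compatible-join [ x ] (ok ∷ c) [ x<y ] = x<y ∷ (ok ∷ c)
  compatible-join (ok ∷ c) c′ (x ∷ lt) = ok ∷ compatible-join c c′ lt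

  compatible-∷ʳ : ∀ {s x y} (σ : List (Fin n)) → Compatible p (σ ∷ʳ x) → Allowed s x y →
                  Compatible (p ∷ʳ s) (σ ∷ʳ x ∷ʳ y)
  compatible-∷ʳ []          [ x ]    ok = ok ∷ [ _ ]
  compatible-∷ʳ (_ ∷ [])    (o ∷ c)  ok = o ∷ compatible-∷ʳ [] c ok
  compatible-∷ʳ (_ ∷ z ∷ σ) (o ∷ c)  ok = o ∷ compatible-∷ʳ (z ∷ σ) c ok

  compatible-backwards : {σ : List (Fin n)} → Compatible p σ → Compatible (backwards p) (reverse σ)
  compatible-backwards [ x ] = [ x ]
  compatible-backwards {p = s ∷ p} (_∷_ {a = a} {b} {σ} ok c) =
    subst₂ Compatible (sym (backwards-∷ s p))
      (sym (trans (unfold-reverse a (b ∷ σ)) (cong (_∷ʳ a) (unfold-reverse b σ))))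
      (compatible-∷ʳ (reverse σ) (subst (Compatible _) (unfold-reverse b σ) (compatible-backwards c)) (allowed s ok))
    where
    allowed : ∀ {x y : Fin _} s → Allowed s x y → Allowed (opposite s) y x
    allowed down lt = lt
    allowed flat _  = tt
    allowed up   lt = lt

  compatible-length : {σ : List (Fin n)} → Compatible p σ → length σ ≡ suc (length p)
  compatible-length [ _ ]   = refl
  compatible-length (_ ∷ c) = cong suc (compatible-length c)

  -- The graph of Φ as an inductive relation

  -- Codes p σ t says that Φ (p , σ) is t. Only the relative order of the labels
  -- matters to Φ, so the standardisations λ_I need not appear.
  data Codes {n : ℕ} : List Step → List (Fin n) → Tree (Fin n) → Set where
    base : x <ᶠ y → Codes (down ∷ []) (x ∷ y ∷ []) (node (leaf x) (leaf y))
    flat : Codes p σ t → Codes (flat ∷ p) (x ∷ σ) (node (leaf x) t)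
    arch : ∀ {σ τ} → Codes (backwards q) (reverse σ) l → Codes p τ r → σ ⊲ τ →
           Codes (q ++ down ∷ p) (σ ++ τ) (node l r)

  -- `arch` in `Codes` leaves `q` free. A Motzkin path ends with `down`, so its reversal starts with
  -- `up`.
  unbackwards : ∀ q → Motzkin (backwards q) → ∃[ e ] q ≡ up ∷ e × Excursion 0 e 0
  -- The path is generalised to `w`, since `backwards q` does not unify with `e ∷ʳ down`.
  unbackwards q mot = go mot refl
    where
    go : ∀ {w} → Motzkin w → w ≡ backwards q → ∃[ e ] q ≡ up ∷ e × Excursion 0 e 0
    go (motzkin {e} x) eq = backwards e ,
      trans (sym (backwards-involutive q)) (trans (cong backwards (sym eq)) (backwards-∷ʳ e down)) ,
      backwards-excursion x

  codes-motzkin : {σ : List (Fin n)} → Codes p σ t → Motzkin p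
  codes-motzkin (base _) = motzkin []
  codes-motzkin (flat c) with motzkin x ← codes-motzkin c = motzkin (flat x)
  codes-motzkin (arch {q} c d _) with _ , refl , x ← unbackwards q (codes-motzkin c) = arch-motzkin x (codes-motzkin d)

  codes-compatible : {σ : List (Fin n)} → Codes p σ t → Compatible p σ
  codes-compatible (base x<y) = x<y ∷ [ _ ]
  codes-compatible (flat c) with codes-compatible c
  ... | [ y ]  = tt ∷ [ y ]
  ... | ok ∷ d = tt ∷ (ok ∷ d)
  codes-compatible (arch {q = q} {σ = σ} c d lt) = compatible-join
    (subst₂ Compatible (backwards-involutive q) (reverse-involutive σ) (compatible-backwards (codes-compatible c)))
    (codes-compatible d) lt

  codes-leaves : {σ : List (Fin n)} → Codes p σ t → σ ↭ leaves t
  codes-leaves (base _)   = ↭-refl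
  codes-leaves (flat c)   = prep _ (codes-leaves c)
  codes-leaves (arch {σ = σ} c d _) = ++⁺ (↭-trans (↭-sym (↭-reverse σ)) (codes-leaves c)) (codes-leaves d)

  -- No tree with a code is a leaf. Hence the leaf attached by `flat` is single, and `arch` creates
  -- no single leaf at its root.
  codes-horizontals : {σ : List (Fin n)} → Codes p σ t → horizontals p ≡ singles t
  codes-horizontals (base _) = refl
  codes-horizontals (flat {t = leaf _} ())
  codes-horizontals (flat {t = node _ _} c) = cong suc (codes-horizontals c)
  codes-horizontals (arch {l = leaf _} () _ _)
  codes-horizontals (arch {l = node _ _} {r = leaf _} _ () _)
  codes-horizontals (arch {q = q} {l = node _ _} {p = p} {r = node _ _} c d _) = begin
    horizontals (q ++ down ∷ p)              ≡⟨ horizontals-++ q (down ∷ p) ⟩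
    horizontals q + horizontals p            ≡⟨ cong (_+ horizontals p) (horizontals-backwards q) ⟨
    horizontals (backwards q) + horizontals p ≡⟨ cong₂ _+_ (codes-horizontals c) (codes-horizontals d) ⟩
    _                                        ∎
    where open ≡-Reasoning

  codes-injective : {σ σ′ : List (Fin n)} → Codes p σ t → Codes q σ′ t′ → t ≅ t′ → p ≡ q × σ ≡ σ′
  codes-injective (base _) (base _) (node leaf leaf) = refl , refl
  codes-injective (base x<y) (base y<x) (swap leaf leaf) = contradiction y<x (Fin.<-asym x<y)
  codes-injective (base _) (flat ()) (node leaf leaf)
  codes-injective (base _) (flat ()) (swap leaf leaf)
  codes-injective (base _) (arch () _ _) (node leaf leaf)
  codes-injective (base _) (arch () _ _) (swap leaf leaf)
  codes-injective (flat ()) (base _) (node leaf leaf)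
  codes-injective (flat ()) (base _) (swap leaf leaf)
  codes-injective (flat c) (flat d) (node leaf s) with refl , refl ← codes-injective c d s = refl , refl
  codes-injective (flat c) (flat ()) (swap leaf _)
  codes-injective (flat _) (arch () _ _) (node leaf _)
  codes-injective (flat _) (arch _ () _) (swap leaf _)
  codes-injective (arch () _ _) (base _) (node leaf leaf)
  codes-injective (arch () _ _) (base _) (swap leaf leaf)
  codes-injective (arch () _ _) (flat _) (node leaf _)
  codes-injective (arch _ () _) (flat _) (swap _ leaf)
  codes-injective (arch {q = q} {σ = σ} c d _) (arch {q = q′} {σ = σ′} c′ d′ _) (node s s′)
    with eq , eq′ ← codes-injective c c′ s | refl , refl ← codes-injective d d′ s′
    with refl ← trans (sym (backwards-involutive q)) (trans (cong backwards eq) (backwards-involutive q′))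
       | refl ← reverse-injective {x = σ} {σ′} eq′ = refl , refl
  -- Crosswise the codes of the subtrees agree by induction, so `lt` and `lt′` compare the same two
  -- first labels in opposite directions.
  codes-injective (arch c d lt) (arch c′ d′ lt′) (swap s s′)
    with _ , eq ← codes-injective c d′ s | _ , eq′ ← codes-injective d c′ s′
       | _ , _ , _ , _ , e₁ , e₂ , x<y ← ⊲-heads lt | _ , _ , _ , _ , e₃ , e₄ , x<y′ ← ⊲-heads lt′
    with refl ← trans (sym e₁) (trans eq e₄) | refl ← trans (sym e₂) (trans eq′ e₃) =
    contradiction x<y′ (Fin.<-asym x<y)

  -- Identifies a tree obtained from `codes-exists` with the one that Φ computes. The equations are
  -- hypotheses because the indices `q ++ down ∷ p` of two `arch` codes do not unify; the cut is
  -- recovered by `firstDescent-unique` and, for the labels, by length.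
  codes-functional : {σ σ′ : List (Fin n)} → Codes p σ t → Codes q σ′ t′ → p ≡ q → σ ≡ σ′ → t ≡ t′
  codes-functional (base _) (base _) _ refl = refl
  codes-functional (base _) (flat _) () _
  codes-functional (flat _) (base _) () _
  codes-functional (flat c) (flat d) refl refl = cong (node (leaf _)) (codes-functional c d refl refl)
  codes-functional (base _) (arch {q} c _ _) eq _ with _ , refl , _ ← unbackwards q (codes-motzkin c) with () ← eq
  codes-functional (flat _) (arch {q} c _ _) eq _ with _ , refl , _ ← unbackwards q (codes-motzkin c) with () ← eq
  codes-functional (arch {q} c _ _) (base _) eq _ with _ , refl , _ ← unbackwards q (codes-motzkin c) with () ← eq
  codes-functional (arch {q} c _ _) (flat _) eq _ with _ , refl , _ ← unbackwards q (codes-motzkin c) with () ← eq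
  codes-functional (arch {q} {σ = σ} c d _) (arch {q′} {σ = σ′} c′ d′ _) eq eqσ
    with _ , refl , x ← unbackwards q (codes-motzkin c) | _ , refl , y ← unbackwards q′ (codes-motzkin c′)
    with refl , refl ← firstDescent-unique x y (∷-injectiveʳ eq)
    with refl , refl ← ++-injective σ σ′ (trans (sym (length-reverse σ)) (trans
           (trans (compatible-length (codes-compatible c)) (sym (compatible-length (codes-compatible c′))))
           (length-reverse σ′))) eqσ =
    cong₂ node (codes-functional c c′ refl refl) (codes-functional d d′ refl refl)

  -- Stated for nodes, since a single leaf has no code. Of two internal children, the one whose code
  -- has the smaller first label becomes the left subtree.
  codes-exists : (l r : Tree (Fin n)) → Unique (leaves (node l r)) →
                 ∃[ p ] ∃[ σ ] ∃[ t ] Codes p σ t × t ≅ node l r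
  codes-exists (leaf x) (leaf y) ((x≢y ∷ []) ∷ _) with Fin.<-cmp x y
  ... | tri< x<y _ _ = _ , _ , _ , base x<y , ≅-refl
  ... | tri≈ _ x≡y _ = contradiction x≡y x≢y
  ... | tri> _ _ y<x = _ , _ , _ , base y<x , swap leaf leaf
  codes-exists (leaf x) (node l r) (_ ∷ u) with _ , _ , _ , c , s ← codes-exists l r u =
    _ , _ , _ , flat c , node leaf s
  codes-exists (node l r) (leaf x) u
    with _ , _ , _ , c , s ← codes-exists l r (proj₁ (Unique-++⁻ (leaves (node l r)) u)) =
    _ , _ , _ , flat c , swap leaf s
  codes-exists (node l r) (node l′ r′) u
    with u₁ , u₂ , disjoint ← Unique-++⁻ (leaves (node l r)) u
    with _ , _ , _ , c , s ← codes-exists l r u₁ | _ , _ , _ , d , s′ ← codes-exists l′ r′ u₂ =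
    combine c s d s′ (codes-compatible c) (codes-compatible d)
    where
    head∈ : ∀ {x t t′ p} {σ : List (Fin _)} → Codes p (x ∷ σ) t → t ≅ t′ → x ∈ leaves t′
    head∈ c s = ∈-resp-↭ (↭-trans (codes-leaves c) (≅⇒leaves↭ s)) (here refl)

    archʳ : ∀ {x y t t′ p q} {σ τ : List (Fin _)} → Codes p (x ∷ σ) t → Codes q (y ∷ τ) t′ → x <ᶠ y →
            Codes (backwards p ++ down ∷ q) (reverse (x ∷ σ) ++ y ∷ τ) (node t t′)
    archʳ {x} {p = p} {σ = σ} c d x<y = arch
      (subst₂ (λ p σ → Codes p σ _) (sym (backwards-involutive p)) (sym (reverse-involutive (x ∷ σ))) c) d
      (⊲-reverse σ _ _ (unfold-reverse x σ) x<y)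

    -- The `Compatible` arguments exclude empty label lists, which the index `σ ++ τ` of `arch` does
    -- not visibly do.
    combine : ∀ {p q σ τ t t′} → Codes p σ t → t ≅ node l r → Codes q τ t′ → t′ ≅ node l′ r′ →
            Compatible p σ → Compatible q τ → ∃[ p ] ∃[ σ ] ∃[ t ] Codes p σ t × t ≅ node (node l r) (node l′ r′)
    combine {σ = x ∷ _} {y ∷ _} c s d s′ _ _ with Fin.<-cmp x y
    ... | tri< x<y _ _ = _ , _ , _ , archʳ c d x<y , node s s′
    ... | tri≈ _ x≡y _ = contradiction (subst (_∈ leaves (node l′ r′)) (sym x≡y) (head∈ d s′)) (disjoint (head∈ c s))
    ... | tri> _ _ y<x = _ , _ , _ , archʳ d c y<x , swap s′ s

  -- Increasing relabellings and standardisation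

  compatible-map⁻ : {f : Fin m → Fin n} → (∀ {i j} → f i <ᶠ f j → i <ᶠ j) →
                    ∀ {σ} → Compatible p (map f σ) → Compatible p σ
  compatible-map⁻ mono {x ∷ []}    [ _ ]    = [ x ]
  compatible-map⁻ mono {x ∷ y ∷ σ} (_∷_ {down} ok c) = mono ok ∷ compatible-map⁻ mono c
  compatible-map⁻ mono {x ∷ y ∷ σ} (_∷_ {flat} ok c) = tt ∷ compatible-map⁻ mono c
  compatible-map⁻ mono {x ∷ y ∷ σ} (_∷_ {up} ok c)   = mono ok ∷ compatible-map⁻ mono c

  ⊲-map : {f : Fin m → Fin n} → (∀ {i j} → i <ᶠ j → f i <ᶠ f j) →
          ∀ {σ τ} → σ ⊲ τ → map f σ ⊲ map f τ
  ⊲-map mono [ x<y ]  = [ mono x<y ]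
  ⊲-map mono (x ∷ lt) = _ ∷ ⊲-map mono lt

  codes-map : {f : Fin m → Fin n} → (∀ {i j} → i <ᶠ j → f i <ᶠ f j) →
              ∀ {σ t} → Codes p σ t → Codes p (map f σ) (relabel f t)
  codes-map mono (base x<y) = base (mono x<y)
  codes-map mono (flat c)   = flat (codes-map mono c)
  codes-map {f = f} mono (arch {σ = σ} {τ} c d lt) = subst (λ ρ → Codes _ ρ _) (sym (map-++ f σ τ))
    (arch (subst (λ ρ → Codes _ ρ _) (reverse-map f σ) (codes-map mono c)) (codes-map mono d) (⊲-map mono lt))

  enum-mono⁺ : (I : Subset n) → ∀ {i j} → i <ᶠ j → enum I i <ᶠ enum I j
  enum-mono⁺ (outside ∷ I)         i<j       = s≤s (enum-mono⁺ I i<j)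
  enum-mono⁺ (inside  ∷ I) {zero}  {suc j} _ = s≤s z≤n
  enum-mono⁺ (inside  ∷ I) {suc i} {suc j} (s≤s i<j) = s≤s (enum-mono⁺ I i<j)

  enum-mono⁻ : (I : Subset n) → ∀ {i j} → enum I i <ᶠ enum I j → i <ᶠ j
  enum-mono⁻ I {i} {j} lt with Fin.<-cmp i j
  ... | tri< i<j _ _  = i<j
  ... | tri≈ _ refl _ = contradiction lt (Fin.<-irrefl refl)
  ... | tri> _ _ j<i  = contradiction lt (Fin.<-asym (enum-mono⁺ I j<i))

  enum-injective : (I : Subset n) → ∀ {i j} → enum I i ≡ enum I j → i ≡ j
  enum-injective I {i} {j} eq with Fin.<-cmp i j
  ... | tri< i<j _ _ = contradiction eq (Fin.<⇒≢ (enum-mono⁺ I i<j))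
  ... | tri≈ _ i≡j _ = i≡j
  ... | tri> _ _ j<i = contradiction (sym eq) (Fin.<⇒≢ (enum-mono⁺ I j<i))

  enum-∈ : (I : Subset n) → ∀ i → enum I i ∈ˢ I
  enum-∈ (outside ∷ I) i       = there (enum-∈ I i)
  enum-∈ (inside  ∷ I) zero    = here
  enum-∈ (inside  ∷ I) (suc i) = there (enum-∈ I i)

  rank-∈ : (I : Subset n) → ∀ {x} → x ∈ˢ I → ∃[ i ] rank I x ≡ just i × enum I i ≡ x
  rank-∈ (inside  ∷ I) here        = zero , refl , refl
  rank-∈ (inside  ∷ I) (there x∈I) with i , eq , refl ← rank-∈ I x∈I = suc i , cong (mapᴹ suc) eq , refl
  rank-∈ (outside ∷ I) (there x∈I) with i , eq , refl ← rank-∈ I x∈I = i , eq , refl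

  mapMaybe-rank : (I : Subset n) → ∀ σ → (∀ {x} → x ∈ σ → x ∈ˢ I) → map (enum I) (mapMaybe (rank I) σ) ≡ σ
  mapMaybe-rank I []      _   = refl
  mapMaybe-rank I (x ∷ σ) σ⊆I with i , eq , refl ← rank-∈ I (σ⊆I (here refl)) rewrite eq =
    cong (enum I i ∷_) (mapMaybe-rank I σ (σ⊆I ∘ there))

  ∈-elements⁺ : {σ : List (Fin n)} → x ∈ σ → x ∈ˢ elements σ
  ∈-elements⁺ (here refl) = x∈p∪q⁺ (inj₁ (x∈⁅x⁆ _))
  ∈-elements⁺ {σ = y ∷ σ} (there x∈σ) = x∈p∪q⁺ {p = ⁅ y ⁆} (inj₂ (∈-elements⁺ x∈σ))

  ∈-elements⁻ : (σ : List (Fin n)) → x ∈ˢ elements σ → x ∈ σ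
  ∈-elements⁻ []      x∈ = contradiction x∈ ∉⊥
  ∈-elements⁻ (y ∷ σ) x∈ with x∈p∪q⁻ ⁅ y ⁆ (elements σ) x∈
  ... | inj₁ x∈y = here (x∈⁅y⁆⇒x≡y y x∈y)
  ... | inj₂ x∈σ = there (∈-elements⁻ σ x∈σ)

  motzkin≢[] : ¬ Motzkin []
  motzkin≢[] mot with () ← motzkinView mot

  x∉p-x : (I : Subset n) → ∀ x → ¬ x ∈ˢ I - x
  x∉p-x (_ ∷ I) (suc x) (there x∈) = x∉p-x I x x∈

  >>=-just : {A B : Set} {f : A → Maybe B} {ma : Maybe A} {a : A} → ma ≡ just a → (ma >>= f) ≡ f a
  >>=-just refl = refl

  zipWith-just : {A B C : Set} {h : A → B → C} {ma : Maybe A} {mb : Maybe B} {a : A} {b : B} →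
                 ma ≡ just a → mb ≡ just b → zipWith h ma mb ≡ just (h a b)
  zipWith-just refl refl = refl

  -- Φ computes codes

  -- The common shape of the recursive calls of Φ, on a block `I` of the labels.
  Φ-on : (b : ℕ) → Subset n → List Step → List (Fin n) → Maybe (Tree (Fin n))
  Φ-on b I p σ = mapᴹ (relabel (enum I)) (Φ-bounded b ∣ I ∣ p (mapMaybe (rank I) σ))

  -- The parameter is the induction hypothesis for the bound `b`, so that each clause of Φ at
  -- `suc b` becomes a separate lemma.
  module _ {b : ℕ} (Φ-correct : ∀ {n p σ} → n ≤ b → Motzkin p → Compatible p σ → Unique σ → length σ ≡ n →
                ∃[ t ] Φ-bounded b n p σ ≡ just t × Codes p σ t) where

    -- Φ recurses at the size `∣ I ∣`, while the bound concerns the length of `σ`. The two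
    -- inclusions make these numbers equal, `σ` being free of duplicates.
    Φ-on-correct : (I : Subset n) {σ : List (Fin n)} → (∀ {x} → x ∈ σ → x ∈ˢ I) → (∀ {x} → x ∈ˢ I → x ∈ σ) →
                   length σ ≤ b → Motzkin p → Compatible p σ → Unique σ →
                   ∃[ t ] Φ-on b I p σ ≡ just t × Codes p σ t
    Φ-on-correct {p = p} I {σ} σ⊆I I⊆σ σ≤b mot comp u =
      let t , eq , c = Φ-correct (subst (_≤ b) ∣I∣≡ σ≤b) mot
                         (compatible-map⁻ (enum-mono⁻ I) (subst (Compatible _) (sym σ≡) comp)) u′ (trans (sym len) ∣I∣≡)
      in relabel (enum I) t , cong (mapᴹ _) eq ,
         subst (λ ρ → Codes p ρ (relabel (enum I) t)) σ≡ (codes-map (enum-mono⁺ I) c)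
      where
      σ′ = mapMaybe (rank I) σ
      σ≡ : map (enum I) σ′ ≡ σ
      σ≡ = mapMaybe-rank I σ σ⊆I
      u′ : Unique σ′
      u′ = Unique.map⁻ (subst Unique (sym σ≡) u)
      len : length σ ≡ length σ′
      len = trans (cong length (sym σ≡)) (length-map (enum I) σ′)
      covers : ∀ {i} → i ∈ allFin ∣ I ∣ → i ∈ σ′
      covers {i} _ with j , j∈σ′ , eq ← ∈-map⁻ (enum I) (subst (enum I i ∈_) (sym σ≡) (I⊆σ (enum-∈ I i)))
        with refl ← enum-injective I eq = j∈σ′
      ∣I∣≡ : length σ ≡ ∣ I ∣
      ∣I∣≡ = trans len (trans (≤-antisym (Unique-⊆⇒length≤ u′ (λ _ → ∈-allFin _)) (Unique-⊆⇒length≤ (allFin⁺ _) covers))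
               (length-tabulate {n = ∣ I ∣} id))

    -- In `Fin 2` a `down` step leaves only the labels 0, 1 in this order, which is why Φ can answer
    -- with a constant tree.
    Φ-end-correct : ∀ n {σ : List (Fin n)} → Compatible (down ∷ []) σ → length σ ≡ n →
                    ∃[ t ] Φ-bounded (suc b) n (down ∷ []) σ ≡ just t × Codes (down ∷ []) σ t
    Φ-end-correct 2 (_∷_ {a = zero} {b = suc zero} x<y [ _ ]) _ = _ , refl , base x<y
    Φ-end-correct 2 (_∷_ {a = suc zero} {b = suc zero} (s≤s ()) [ _ ]) _

    Φ-flat-correct : ∀ n {σ : List (Fin n)} → n ≤ suc b → Motzkin p → Compatible (flat ∷ p) σ →
                     Unique σ → length σ ≡ n →
                     ∃[ t ] Φ-bounded (suc b) n (flat ∷ p) σ ≡ just t × Codes (flat ∷ p) σ t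
    Φ-flat-correct _ _ mot (_ ∷ [ _ ]) _ _ = contradiction mot motzkin≢[]
    Φ-flat-correct {p} (suc (suc (suc _))) {x ∷ σ} n≤b mot (_ ∷ c@(_ ∷ _)) u len =
      let t , eq , c′ = Φ-on-correct (⊤ - x) avoids others
                          (≤-pred (subst (_≤ suc b) (sym len) n≤b)) mot c (AllPairs.tail u)
      in node (leaf x) t ,
         -- Φ relabels and attaches the leaf in a single `mapᴹ`; splitting it exposes `Φ-on`.
         trans (mapᴹ-∘ (Φ-bounded b ∣ ⊤ - x ∣ p (mapMaybe (rank (⊤ - x)) σ))) (cong (mapᴹ (node (leaf x))) eq) ,
         flat c′
      where
      avoids : ∀ {y} → y ∈ σ → y ∈ˢ ⊤ - x
      avoids y∈σ = x∈p∧x≢y⇒x∈p-y ∈⊤ (λ { refl → Unique[x∷xs]⇒x∉xs u y∈σ })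
      others : ∀ {y} → y ∈ˢ ⊤ - x → y ∈ σ
      others {y} y∈ with ∈-resp-↭ (↭-sym (Unique⇒↭allFin u len)) (∈-allFin y)
      ... | here refl = contradiction y∈ (x∉p-x ⊤ _)
      ... | there y∈σ = y∈σ

    Φ-arch-correct : ∀ n {σ₁ σ₂ : List (Fin n)} → n ≤ suc b → Excursion 0 e 0 → Motzkin q →
                     Compatible (up ∷ e) σ₁ → Compatible q σ₂ → σ₁ ⊲ σ₂ → Unique (σ₁ ++ σ₂) → length (σ₁ ++ σ₂) ≡ n →
                     ∃[ t ] Φ-bounded (suc b) n ((up ∷ e) ++ down ∷ q) (σ₁ ++ σ₂) ≡ just t ×
                            Codes ((up ∷ e) ++ down ∷ q) (σ₁ ++ σ₂) t
    -- `σ₁` has at least two labels and `σ₂` at least one, which excludes the sizes below 3.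
    Φ-arch-correct 0 _ _ _ (_ ∷ _) _ _ _ ()
    Φ-arch-correct 1 _ _ _ (_ ∷ _) _ _ _ ()
    Φ-arch-correct 2 _ _ _ (_∷_ {σ = ρ} _ _) c₂ _ _ len =
      contradiction (suc-injective (suc-injective len)) (m+1+n≢0 (length ρ) ∘ trans (sym
        (trans (length-++ ρ) (cong₂ _+_ (refl {x = length ρ}) (compatible-length c₂)))))
    Φ-arch-correct {e} {q} n@(suc (suc (suc _))) {σ₁} {σ₂} n≤b x mot c₁ c₂ lt u len =
      let u₁ , u₂ , _ = Unique-++⁻ σ₁ u
          l , eq , cl = Φ-on-correct (elements σ₁) (λ z∈ → ∈-elements⁺ (∈-resp-↭ (↭-reverse σ₁) z∈))
                          (λ z∈ → ∈-resp-↭ (↭-sym (↭-reverse σ₁)) (∈-elements⁻ σ₁ z∈))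
                          (subst (_≤ b) (sym (length-reverse σ₁)) σ₁≤b)
                          (backwards-arch x) (compatible-backwards c₁) (Unique-resp-↭ (↭-sym (↭-reverse σ₁)) u₁)
          r , eq′ , cr = Φ-on-correct (elements σ₂) ∈-elements⁺ (∈-elements⁻ σ₂) σ₂≤b mot c₂ u₂
      in node l r ,
         trans (>>=-just (firstReturn-arch x q))
           (zipWith-just {h = node} (trans (cong₂ Φ-left take-p take-σ) eq) (trans (cong₂ Φ-right drop-p drop-σ) eq′)) ,
         arch {q = up ∷ e} cl cr lt
      where
      k = suc (suc (length e))
      w = (up ∷ e) ++ down ∷ q
      Φ-left  = λ p σ → Φ-on b (elements σ) (backwards p) (reverse σ)
      Φ-right = λ p σ → Φ-on b (elements σ) p σ
      len₁ : length σ₁ ≡ k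
      len₁ = compatible-length c₁
      len₁₂ : length σ₁ + length σ₂ ≡ n
      len₁₂ = trans (sym (length-++ σ₁)) len
      -- A block of `k` labels has `k - 1` steps; step number `k`, the `down`, is left out on both
      -- sides.
      take-p : take (k ∸ 1) w ≡ up ∷ e
      take-p = take-++ (up ∷ e) refl
      drop-p : drop k w ≡ q
      drop-p = trans (cong (drop k) (sym (++-assoc (up ∷ e) (down ∷ []) q)))
                 (drop-++ ((up ∷ e) ++ down ∷ []) (trans (length-++ (up ∷ e)) (+-comm (length (up ∷ e)) 1)))
      take-σ : take k (σ₁ ++ σ₂) ≡ σ₁
      take-σ = take-++ σ₁ len₁
      drop-σ : drop k (σ₁ ++ σ₂) ≡ σ₂
      drop-σ = drop-++ σ₁ len₁
      σ₁≤b : length σ₁ ≤ b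
      σ₁≤b = ≤-pred (begin
        suc (length σ₁)          ≡⟨ +-comm 1 _ ⟩
        length σ₁ + 1            ≤⟨ +-monoʳ-≤ (length σ₁) (subst (1 ≤_) (sym (compatible-length c₂)) (s≤s z≤n)) ⟩
        length σ₁ + length σ₂    ≡⟨ len₁₂ ⟩
        n                        ≤⟨ n≤b ⟩
        suc b                    ∎)
        where open ≤-Reasoning
      σ₂≤b : length σ₂ ≤ b
      σ₂≤b = ≤-pred (begin
        suc (length σ₂)          ≤⟨ +-monoˡ-≤ (length σ₂) (subst (1 ≤_) (sym len₁) (s≤s z≤n)) ⟩
        length σ₁ + length σ₂    ≡⟨ len₁₂ ⟩
        n                        ≤⟨ n≤b ⟩
        suc b                    ∎)
        where open ≤-Reasoning

  -- The rest after a `flat` and both blocks of an `arch` are strictly shorter, so a bound that is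
  -- at least the size never runs out.
  Φ-correct : ∀ b {n p σ} → n ≤ b → Motzkin p → Compatible p σ → Unique σ → length σ ≡ n →
              ∃[ t ] Φ-bounded b n p σ ≡ just t × Codes p σ t
  Φ-correct zero    z≤n _ [ _ ] _ ()
  Φ-correct zero    z≤n _ (_ ∷ _) _ ()
  Φ-correct (suc b) n≤b mot comp u len with motzkinView mot
  ... | end       = Φ-end-correct (Φ-correct b) _ comp len
  ... | flat mot′ = Φ-flat-correct (Φ-correct b) _ n≤b mot′ comp u len
  ... | arch {e} x mot′ with σ₁ , σ₂ , refl , c₁ , c₂ , lt ← compatible-split (up ∷ e) comp =
    Φ-arch-correct (Φ-correct b) _ n≤b x mot′ c₁ c₂ lt u len

  -- The bijection given by Φ

  module _ (n k : ℕ) (2≤n : 2 ≤ n) where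
    open MotzkinPath renaming (motzkin to isMotzkin)
    open BinaryTree

    Φ-tree : (w : MotzkinPath n k) → ∃[ t ] Φ (word w) ≡ just t × Codes (steps w) (labels w) t
    Φ-tree w = Φ-correct n ≤-refl (IsMotzkin⇒motzkin 2≤n length-p (isMotzkin w)) compatible
      (Unique-resp-↭ (↭-sym permutation) (allFin⁺ n)) (trans (↭-length permutation) (length-tabulate {n = n} id))
      where open IsWellLabelled (wellLabelled w)

    Φ-to : MotzkinPath n k → BinaryTree n k
    Φ-to w with t , eq , c ← Φ-tree w = record
      { tree     = t
      ; n-leaves = trans (↭-length (↭-trans (↭-sym (codes-leaves c)) permutation)) (length-tabulate {n = n} id)
      ; distinct = Unique-resp-↭ (↭-trans (↭-sym permutation) (codes-leaves c)) (allFin⁺ n)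
      ; k-single = trans (sym (codes-horizontals c)) (k-horizontal w)
      }
      where open IsWellLabelled (wellLabelled w)

    Φ-to-correct : ∀ w → Φ (word w) ≡ just (tree (Φ-to w))
    Φ-to-correct w = proj₁ (proj₂ (Φ-tree w))

    Φ-to-cong : ∀ {w w′} → word w ≡ word w′ → tree (Φ-to w) ≅ tree (Φ-to w′)
    Φ-to-cong {w} {w′} eq = subst (tree (Φ-to w) ≅_)
      (just-injective (trans (sym (Φ-to-correct w)) (trans (cong Φ eq) (Φ-to-correct w′)))) ≅-refl

    Φ-to-injective : ∀ {w w′} → tree (Φ-to w) ≅ tree (Φ-to w′) → word w ≡ word w′
    Φ-to-injective {w} {w′} s
      with refl , refl ← codes-injective (proj₂ (proj₂ (Φ-tree w))) (proj₂ (proj₂ (Φ-tree w′))) s = refl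

    -- A code of the tree supplies the path, and `codes-functional` shows that Φ returns the tree of
    -- that code, which is the given one up to `_≅_`.
    Φ-from : (t : BinaryTree n k) → ∃[ w ] tree (Φ-to w) ≅ tree t
    Φ-from record { tree = leaf _ ; n-leaves = 1≡n } = contradiction (subst (2 ≤_) (sym 1≡n) 2≤n) λ { (s≤s ()) }
    Φ-from record { tree = node l r ; n-leaves = len ; distinct = u ; k-single = single }
      with p , σ , t , c , s ← codes-exists l r u =
      w , subst (_≅ node l r) (codes-functional c (proj₂ (proj₂ (Φ-tree w))) refl refl) s
      where
      σ↭ : σ ↭ leaves (node l r)
      σ↭ = ↭-trans (codes-leaves c) (≅⇒leaves↭ s)
      length-p : length p ≡ n ∸ 1
      length-p = cong (_∸ 1) (trans (sym (compatible-length (codes-compatible c))) (trans (↭-length σ↭) len))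
      w : MotzkinPath n k
      w = record
        { steps = p
        ; labels = σ
        ; wellLabelled = record
          { length-p    = length-p
          ; permutation = Unique⇒↭allFin (Unique-resp-↭ (↭-sym σ↭) u) (trans (↭-length σ↭) len)
          ; compatible  = codes-compatible c
          }
        ; motzkin = motzkin⇒IsMotzkin (codes-motzkin c) length-p
        ; k-horizontal = trans (codes-horizontals c) (trans (≅⇒singles≡ s) single)
        }

    Φ-bijection : Bijection (MotzkinPaths n k) (BinaryTrees n k)
    Φ-bijection = record
      { to = Φ-to
      ; cong = λ {w} {w′} → Φ-to-cong {w} {w′}
      ; bijective = (λ {w} {w′} → Φ-to-injective {w} {w′}) ,
          λ t → let w , s = Φ-from t in w , λ {z} eq → ≅-trans (Φ-to-cong {z} {w} eq) s
      }

-- The greedy labelling and the map Ψ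

module Ψ-bijective where

  private variable
    a b c k v x y : ℕ
    l r s t s′ t′ : Tree ℕ
    T U : Partial
    ps : List (ℕ × ℕ)

  -- Cherries and their contraction

  -- A cherry is a pair of sibling leaves; comparing up to `_≅_` leaves their order open.
  data Cherry (a b : ℕ) : Tree ℕ → Set where
    here  : t ≅ node (leaf a) (leaf b) → Cherry a b t
    left  : Cherry a b l → Cherry a b (node l r)
    right : Cherry a b r → Cherry a b (node l r)

  -- Read from the second tree to the first, this contracts a cherry to the leaf `v`; read the other
  -- way, `v` sprouts the cherry. A relation serves both directions: contraction when the tree is
  -- given, growth when the matching is given.
  data Graft (v a b : ℕ) : Tree ℕ → Tree ℕ → Set where
    here  : t ≅ node (leaf a) (leaf b) → Graft v a b (leaf v) t
    left  : Graft v a b l s → Graft v a b (node l r) (node s r)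
    right : Graft v a b r s → Graft v a b (node l r) (node l s)

  ¬graft-leaf : ¬ Graft v a b s (leaf x)
  ¬graft-leaf (here ())

  cherry-sym : Cherry a b t → Cherry b a t
  cherry-sym (here e)  = here (≅-trans e (swap leaf leaf))
  cherry-sym (left c)  = left (cherry-sym c)
  cherry-sym (right c) = right (cherry-sym c)

  cherry-≅ : Cherry a b s → s ≅ t → Cherry a b t
  cherry-≅ (here e)  s≅t        = here (≅-trans (≅-sym s≅t) e)
  cherry-≅ (left c)  (node p _) = left (cherry-≅ c p)
  cherry-≅ (left c)  (swap p _) = right (cherry-≅ c p)
  cherry-≅ (right c) (node _ q) = right (cherry-≅ c q)
  cherry-≅ (right c) (swap _ q) = left (cherry-≅ c q)

  cherry⇒graft : ∀ v → Cherry a b t → ∃[ s ] Graft v a b s t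
  cherry⇒graft v (here e) = leaf v , here e
  cherry⇒graft v (left c)  with _ , g ← cherry⇒graft v c = _ , left g
  cherry⇒graft v (right c) with _ , g ← cherry⇒graft v c = _ , right g

  graft⇒cherry : Graft v a b s t → Cherry a b t
  graft⇒cherry (here e)  = here e
  graft⇒cherry (left g)  = left (graft⇒cherry g)
  graft⇒cherry (right g) = right (graft⇒cherry g)

  leaf⇒graft : ∀ a b (s : Tree ℕ) → v ∈ leaves s → ∃[ t ] Graft v a b s t
  leaf⇒graft a b (leaf v) (here refl) = _ , here ≅-refl
  leaf⇒graft a b (node l r) v∈ with ∈-++⁻ (leaves l) v∈
  ... | inj₁ v∈l with _ , g ← leaf⇒graft a b l v∈l = _ , left g
  ... | inj₂ v∈r with _ , g ← leaf⇒graft a b r v∈r = _ , right g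

  cherry-graft⁺ : Graft v a b s t → x ≢ v → y ≢ v → Cherry x y s → Cherry x y t
  cherry-graft⁺ (here _)  _ _ (here ())
  cherry-graft⁺ (left g)  x≢v y≢v (left c)  = left (cherry-graft⁺ g x≢v y≢v c)
  cherry-graft⁺ (left g)  _ _ (right c) = right c
  cherry-graft⁺ (right g) x≢v y≢v (right c) = right (cherry-graft⁺ g x≢v y≢v c)
  cherry-graft⁺ (right g) _ _ (left c)  = left c
  cherry-graft⁺ (left (here _))  x≢v _ (here (node leaf _)) = contradiction refl x≢v
  cherry-graft⁺ (left (here _))  _ y≢v (here (swap leaf _)) = contradiction refl y≢v
  cherry-graft⁺ (right (here _)) _ y≢v (here (node _ leaf)) = contradiction refl y≢v
  cherry-graft⁺ (right (here _)) x≢v _ (here (swap _ leaf)) = contradiction refl x≢v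

  cherry-graft⁻ : Graft v a b s t → Cherry x y t → (x ≡ a × y ≡ b) ⊎ (x ≡ b × y ≡ a) ⊎ Cherry x y s
  cherry-graft⁻ (here (node leaf leaf)) (here (node leaf leaf)) = inj₁ (refl , refl)
  cherry-graft⁻ (here (node leaf leaf)) (here (swap leaf leaf)) = inj₂ (inj₁ (refl , refl))
  cherry-graft⁻ (here (swap leaf leaf)) (here (node leaf leaf)) = inj₂ (inj₁ (refl , refl))
  cherry-graft⁻ (here (swap leaf leaf)) (here (swap leaf leaf)) = inj₁ (refl , refl)
  cherry-graft⁻ (here (node leaf leaf)) (left (here ()))
  cherry-graft⁻ (here (node leaf leaf)) (right (here ()))
  cherry-graft⁻ (here (swap leaf leaf)) (left (here ()))
  cherry-graft⁻ (here (swap leaf leaf)) (right (here ()))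
  cherry-graft⁻ (left g)  (here (node leaf leaf)) = contradiction g ¬graft-leaf
  cherry-graft⁻ (left g)  (here (swap leaf leaf)) = contradiction g ¬graft-leaf
  cherry-graft⁻ (right g) (here (node leaf leaf)) = contradiction g ¬graft-leaf
  cherry-graft⁻ (right g) (here (swap leaf leaf)) = contradiction g ¬graft-leaf
  cherry-graft⁻ (left g)  (left c) with cherry-graft⁻ g c
  ... | inj₁ e        = inj₁ e
  ... | inj₂ (inj₁ e) = inj₂ (inj₁ e)
  ... | inj₂ (inj₂ d) = inj₂ (inj₂ (left d))
  cherry-graft⁻ (left g)  (right c) = inj₂ (inj₂ (right c))
  cherry-graft⁻ (right g) (left c)  = inj₂ (inj₂ (left c))
  cherry-graft⁻ (right g) (right c) with cherry-graft⁻ g c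
  ... | inj₁ e        = inj₁ e
  ... | inj₂ (inj₁ e) = inj₂ (inj₁ e)
  ... | inj₂ (inj₂ d) = inj₂ (inj₂ (right d))

  graft-≅ : Graft v a b s t → t ≅ t′ → ∃[ s′ ] Graft v a b s′ t′ × s ≅ s′
  graft-≅ (here e)  p          = _ , here (≅-trans (≅-sym p) e) , leaf
  graft-≅ (left g)  (node p q) with _ , g′ , i ← graft-≅ g p = _ , left g′ , node i q
  graft-≅ (left g)  (swap p q) with _ , g′ , i ← graft-≅ g p = _ , right g′ , swap i q
  graft-≅ (right g) (node p q) with _ , g′ , i ← graft-≅ g q = _ , right g′ , node p i
  graft-≅ (right g) (swap p q) with _ , g′ , i ← graft-≅ g q = _ , left g′ , swap p i

  graft-leaves : Graft v a b s t → ∃[ xs ] leaves s ↭ v ∷ xs × leaves t ↭ a ∷ b ∷ xs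
  graft-leaves (here e) = [] , ↭-refl , ≅⇒leaves↭ e
  graft-leaves {v} {a} {b} (left {l} {s} {r} g) with xs , p , q ← graft-leaves g =
    xs ++ leaves r , ++⁺ʳ (leaves r) p , ++⁺ʳ (leaves r) q
  graft-leaves {v} {a} {b} (right {r} {s} {l} g) with xs , p , q ← graft-leaves g =
    leaves l ++ xs , ↭-trans (++⁺ˡ (leaves l) p) (shift v (leaves l) xs) ,
    ↭-trans (++⁺ˡ (leaves l) q) (↭-trans (shift a (leaves l) (b ∷ xs)) (prep a (shift b (leaves l) xs)))

  graft-∈ : Graft v a b s t → v ∈ leaves s
  graft-∈ g with xs , p , _ ← graft-leaves g = ∈-resp-↭ (↭-sym p) (here refl)

  -- Uniqueness puts `v` in one subtree only, so both grafts take place at corresponding leaves.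
  graft-determined : Graft v a b s t → Graft v a b s′ t′ → s ≅ s′ → Unique (leaves s) → t ≅ t′
  graft-determined (here e) (here e′) leaf _ = ≅-trans e (≅-sym e′)
  graft-determined (left {l} g) (left g′) (node p q) u =
    node (graft-determined g g′ p (proj₁ (Unique-++⁻ (leaves l) u))) q
  graft-determined (left {l} g) (right g′) (node p q) u = contradiction
    (∈-resp-↭ (≅⇒leaves↭ (≅-sym q)) (graft-∈ g′)) (proj₂ (proj₂ (Unique-++⁻ (leaves l) u)) (graft-∈ g))
  graft-determined (right {l = l} g) (left g′) (node p q) u = contradiction
    (graft-∈ g) (proj₂ (proj₂ (Unique-++⁻ (leaves l) u)) (∈-resp-↭ (≅⇒leaves↭ (≅-sym p)) (graft-∈ g′)))
  graft-determined (right {l = l} g) (right g′) (node p q) u =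
    node p (graft-determined g g′ q (proj₁ (proj₂ (Unique-++⁻ (leaves l) u))))
  graft-determined (left {l} g) (left g′) (swap p q) u = contradiction
    (∈-resp-↭ (≅⇒leaves↭ (≅-sym q)) (graft-∈ g′)) (proj₂ (proj₂ (Unique-++⁻ (leaves l) u)) (graft-∈ g))
  graft-determined (left {l} g) (right g′) (swap p q) u =
    swap (graft-determined g g′ p (proj₁ (Unique-++⁻ (leaves l) u))) q
  graft-determined (right {l = l} g) (left g′) (swap p q) u =
    swap p (graft-determined g g′ q (proj₁ (proj₂ (Unique-++⁻ (leaves l) u))))
  graft-determined (right {l = l} g) (right g′) (swap p q) u = contradiction
    (graft-∈ g) (proj₂ (proj₂ (Unique-++⁻ (leaves l) u)) (∈-resp-↭ (≅⇒leaves↭ (≅-sym p)) (graft-∈ g′)))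

  -- Greedy contraction

  -- The invariant before `v` is given out: `v` is new and exceeds all labels present.
  record Fresh (v : ℕ) (xs : List ℕ) : Set where
    constructor fresh
    field
      unique : Unique xs
      below  : All (_< v) xs

  fresh-resp-↭ : ∀ {xs ys} → xs ↭ ys → Fresh v xs → Fresh v ys
  fresh-resp-↭ p (fresh u lt) = fresh (Unique-resp-↭ p u) (All-resp-↭ p lt)

  fresh-step : ∀ {xs} → Fresh v (a ∷ b ∷ xs) → Fresh (suc v) (v ∷ xs)
  fresh-step (fresh (_ ∷ _ ∷ u) (_ ∷ _ ∷ lt)) =
    fresh (All.map (λ x<v v≡x → <⇒≢ x<v (sym v≡x)) lt ∷ u) (≤-refl ∷ All.map m<n⇒m<1+n lt)

  fresh-graft : Graft v a b s t → Fresh v (leaves t) → Fresh (suc v) (leaves s)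
  fresh-graft g f with xs , p , q ← graft-leaves g = fresh-resp-↭ (↭-sym p) (fresh-step (fresh-resp-↭ q f))

  -- Greedy v k t ps: contracting k times the cherry with the least label, the
  -- contracted cherries becoming leaves v, v + 1, …, turns t into a single cherry;
  -- ps lists the cherries met, the final one included.
  data Greedy : ℕ → ℕ → Tree ℕ → List (ℕ × ℕ) → Set where
    root : t ≅ node (leaf a) (leaf b) → Greedy v 0 t ((a , b) ∷ [])
    step : Graft v a b s t → a < b → (∀ {x y} → Cherry x y t → a ≤ x) → Greedy (suc v) k s ps →
           Greedy v (suc k) t ((a , b) ∷ ps)

  -- Both orientations are listed, so that the arcs form the graph of the mate map and `ends` its
  -- domain.
  arcs : List (ℕ × ℕ) → List (ℕ × ℕ)
  arcs []             = []
  arcs ((a , b) ∷ ps) = (a , b) ∷ (b , a) ∷ arcs ps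

  ends : List (ℕ × ℕ) → List ℕ
  ends ps = map proj₁ (arcs ps)

  range : ℕ → ℕ → List ℕ
  range v zero    = []
  range v (suc k) = v ∷ range (suc v) k

  arcs-sym : ∀ ps → (x , y) ∈ arcs ps → (y , x) ∈ arcs ps
  arcs-sym (_ ∷ ps) (here refl)         = there (here refl)
  arcs-sym (_ ∷ ps) (there (here refl)) = here refl
  arcs-sym (_ ∷ ps) (there (there p))   = there (there (arcs-sym ps p))

  arcs-ends : (x , y) ∈ arcs ps → x ∈ ends ps
  arcs-ends = ∈-map⁺ proj₁

  ends-arcs : x ∈ ends ps → ∃[ y ] (x , y) ∈ arcs ps
  ends-arcs x∈ with (_ , y) , p , refl ← ∈-map⁻ proj₁ x∈ = y , p

  arcs-irrefl : ∀ ps → Unique (ends ps) → (x , y) ∈ arcs ps → x ≢ y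
  arcs-irrefl (_ ∷ ps) ((a≢b ∷ _) ∷ _) (here refl)         = a≢b
  arcs-irrefl (_ ∷ ps) ((a≢b ∷ _) ∷ _) (there (here refl)) = a≢b ∘ sym
  arcs-irrefl (_ ∷ ps) (_ ∷ _ ∷ u)     (there (there p))   = arcs-irrefl ps u p

  -- A contraction uses up `a` and `b` for good and turns `v` from a label to come into a leaf, so
  -- every label is met in exactly one cherry.
  greedy-ends : Greedy v k t ps → ends ps ↭ leaves t ++ range v k
  greedy-ends {t = t} (root e) = ↭-trans (↭-sym (≅⇒leaves↭ e)) (↭-reflexive (sym (++-identityʳ (leaves t))))
  greedy-ends {v} {suc k} {t} (step {a = a} {b} {s} {ps = ps} g _ _ G) with xs , p , q ← graft-leaves g = begin
    a ∷ b ∷ ends ps                          ↭⟨ prep a (prep b (greedy-ends G)) ⟩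
    a ∷ b ∷ leaves s ++ range (suc v) k      ↭⟨ prep a (prep b (++⁺ʳ _ p)) ⟩
    a ∷ b ∷ v ∷ xs ++ range (suc v) k        ↭⟨ prep a (prep b (shift v xs _)) ⟨
    a ∷ b ∷ xs ++ v ∷ range (suc v) k        ↭⟨ ++⁺ʳ _ q ⟨
    leaves t ++ v ∷ range (suc v) k          ∎
    where open PermutationReasoning

  -- The list `ps` is kept unchanged, which makes Ψ well defined on unordered trees.
  greedy-≅ : Greedy v k s ps → s ≅ t → Greedy v k t ps
  greedy-≅ (root e) i = root (≅-trans (≅-sym i) e)
  greedy-≅ (step g a<b least G) i with _ , g′ , j ← graft-≅ g i =
    step g′ a<b (λ c → least (cherry-≅ c (≅-sym i))) (greedy-≅ G j)

  -- A contraction can create only cherries that contain the new label, so mates below `v` are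
  -- siblings from the beginning.
  greedy-arc⇒cherry : Greedy v k t ps → (x , y) ∈ arcs ps → x < v → y < v → Cherry x y t
  greedy-arc⇒cherry (root e) (here refl)         _ _ = here e
  greedy-arc⇒cherry (root e) (there (here refl)) _ _ = cherry-sym (here e)
  greedy-arc⇒cherry (step g _ _ G) (here refl)         _ _ = graft⇒cherry g
  greedy-arc⇒cherry (step g _ _ G) (there (here refl)) _ _ = cherry-sym (graft⇒cherry g)
  greedy-arc⇒cherry (step g _ _ G) (there (there p)) x<v y<v =
    cherry-graft⁺ g (<⇒≢ x<v) (<⇒≢ y<v) (greedy-arc⇒cherry G p (m<n⇒m<1+n x<v) (m<n⇒m<1+n y<v))

  greedy-cherry⇒arc : Greedy v k t ps → Cherry x y t → (x , y) ∈ arcs ps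
  greedy-cherry⇒arc (root e) c with cherry-graft⁻ {v = 0} (here e) c
  ... | inj₁ (refl , refl)        = here refl
  ... | inj₂ (inj₁ (refl , refl)) = there (here refl)
  ... | inj₂ (inj₂ (here ()))
  greedy-cherry⇒arc (step g _ _ G) c with cherry-graft⁻ g c
  ... | inj₁ (refl , refl)        = here refl
  ... | inj₂ (inj₁ (refl , refl)) = there (here refl)
  ... | inj₂ (inj₂ d)             = there (there (greedy-cherry⇒arc G d))

  -- Existence of the greedy contraction

  least-cherry : (l r : Tree ℕ) → Unique (leaves (node l r)) →
                 ∃[ a ] ∃[ b ] a < b × Cherry a b (node l r) × (∀ {x y} → Cherry x y (node l r) → a ≤ x)
  least-cherry (leaf x) (leaf y) ((x≢y ∷ []) ∷ _) with <-cmp x y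
  ... | tri< x<y _ _ = x , y , x<y , here ≅-refl , λ where
    (here (node leaf leaf)) → ≤-refl
    (here (swap leaf leaf)) → <⇒≤ x<y
    (left (here ()))
    (right (here ()))
  ... | tri≈ _ x≡y _ = contradiction x≡y x≢y
  ... | tri> _ _ y<x = y , x , y<x , here (swap leaf leaf) , λ where
    (here (node leaf leaf)) → <⇒≤ y<x
    (here (swap leaf leaf)) → ≤-refl
    (left (here ()))
    (right (here ()))
  least-cherry (leaf x) (node l r) (_ ∷ u) with a , b , a<b , c , least ← least-cherry l r u =
    a , b , a<b , right c , λ where
      (here (node _ ()))
      (here (swap _ ()))
      (left (here ()))
      (right d) → least d
  least-cherry (node l r) (leaf x) u
    with a , b , a<b , c , least ← least-cherry l r (proj₁ (Unique-++⁻ (leaves (node l r)) u)) =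
    a , b , a<b , left c , λ where
      (here (node () _))
      (here (swap () _))
      (right (here ()))
      (left d) → least d
  least-cherry (node l r) (node l′ r′) u
    with u₁ , u₂ , _ ← Unique-++⁻ (leaves (node l r)) u
    with a , b , a<b , c , least ← least-cherry l r u₁ | a′ , b′ , a′<b′ , c′ , least′ ← least-cherry l′ r′ u₂
    with ≤-total a a′
  ... | inj₁ a≤a′ = a , b , a<b , left c , λ where
      (here (node () _))
      (here (swap () _))
      (left d)  → least d
      (right d) → ≤-trans a≤a′ (least′ d)
  ... | inj₂ a′≤a = a′ , b′ , a′<b′ , right c′ , λ where
      (here (node () _))
      (here (swap () _))
      (left d)  → ≤-trans a′≤a (least d)
      (right d) → least′ d

  0<leaves : {A : Set} (t : Tree A) → 0 < length (leaves t)
  0<leaves (leaf _)   = s≤s z≤n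
  0<leaves (node l r) = subst (0 <_) (sym (length-++ (leaves l))) (≤-trans (0<leaves l) (m≤m+n _ _))

  graft-size : Graft v a b s t → length (leaves t) ≡ suc (length (leaves s))
  graft-size g with xs , p , q ← graft-leaves g = trans (↭-length q) (cong suc (sym (↭-length p)))

  2≤leaves : {A : Set} (l r : Tree A) → 2 ≤ length (leaves (node l r))
  2≤leaves l r = subst (2 ≤_) (sym (length-++ (leaves l))) (+-mono-≤ (0<leaves l) (0<leaves r))

  two-leaves : (t : Tree ℕ) → length (leaves t) ≡ 2 → ∃[ a ] ∃[ b ] t ≡ node (leaf a) (leaf b)
  two-leaves (node (leaf a) (leaf b)) _ = a , b , refl
  two-leaves (node (leaf a) (node l r)) eq =
    contradiction (2≤leaves l r) (<⇒≱ (subst (_< 2) (sym (suc-injective eq)) ≤-refl))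
  two-leaves (node t@(node l r) s) eq = contradiction
    (+-mono-≤ (2≤leaves l r) (0<leaves s)) (<⇒≱ (subst (_< 3) (trans (sym eq) (length-++ (leaves t))) ≤-refl))

  greedy-exists : ∀ k v (t : Tree ℕ) → length (leaves t) ≡ 2 + k → Fresh v (leaves t) → ∃[ ps ] Greedy v k t ps
  greedy-exists zero v t eq f with a , b , refl ← two-leaves t eq = _ , root ≅-refl
  greedy-exists (suc k) v (node l r) eq f
    with a , b , a<b , c , least ← least-cherry l r (Fresh.unique f)
    with s , g ← cherry⇒graft v c
    with ps , G ← greedy-exists k (suc v) s (suc-injective (trans (sym (graft-size g)) eq)) (fresh-graft g f) =
    _ , step g a<b least G

  -- The matching determines the tree

  greedy-mates⇒cherry : (mate : ℕ → Maybe ℕ) → (∀ {x y} → (x , y) ∈ arcs ps → mate x ≡ just y) →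
                        Greedy v k t ps → Fresh v (leaves t) → x ∈ leaves t → y ∈ leaves t →
                        mate x ≡ just y → Cherry x y t
  greedy-mates⇒cherry {ps = ps} mate m G f x∈ y∈ eq
    with _ , arc ← ends-arcs {ps = ps} (∈-resp-↭ (↭-sym (greedy-ends G)) (∈-++⁺ˡ x∈))
    with refl ← just-injective (trans (sym (m arc)) eq) =
    greedy-arc⇒cherry G arc (All.lookup (Fresh.below f) x∈) (All.lookup (Fresh.below f) y∈)

  -- The common function `mate` stands for the matching. It forces both runs to contract the same
  -- cherry, after which the contracted trees have the same leaves again, and `graft-determined`
  -- undoes the contraction.
  greedy-injective : ∀ {qs} (mate : ℕ → Maybe ℕ) →
                     (∀ {x y} → (x , y) ∈ arcs ps → mate x ≡ just y) → (∀ {x y} → (x , y) ∈ arcs qs → mate x ≡ just y) →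
                     Fresh v (leaves s) → leaves s ↭ leaves t → Greedy v k s ps → Greedy v k t qs → s ≅ t
  greedy-injective mate mp mq f p (root e) (root e′)
    with ∈-resp-↭ (↭-trans (↭-sym (≅⇒leaves↭ e)) (↭-trans p (≅⇒leaves↭ e′))) (here refl)
  ... | here refl with refl ← just-injective (trans (sym (mp (here refl))) (mq (here refl))) = ≅-trans e (≅-sym e′)
  ... | there (here refl) with refl ← just-injective (trans (sym (mp (here refl))) (mq (there (here refl)))) =
    ≅-trans e (≅-trans (swap leaf leaf) (≅-sym e′))
  greedy-injective {v = v} {s} {t} mate mp mq f p G@(step {a = a} {b} g _ least G′) H@(step {a = a′} {b′} h _ least′ H′)
    with xs , p₁ , q₁ ← graft-leaves g | ys , p₂ , q₂ ← graft-leaves h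
    -- The first cherry of each run consists of mates among the current leaves, so it is a cherry of
    -- the other tree as well.
    with refl ← ≤-antisym
           (least (greedy-mates⇒cherry mate mp G f (∈-resp-↭ (↭-sym (↭-trans p q₂)) (here refl))
              (∈-resp-↭ (↭-sym (↭-trans p q₂)) (there (here refl))) (mq (here refl))))
           (least′ (greedy-mates⇒cherry mate mq H (fresh-resp-↭ p f) (∈-resp-↭ (↭-trans (↭-sym q₁) p) (here refl))
              (∈-resp-↭ (↭-trans (↭-sym q₁) p) (there (here refl))) (mp (here refl))))
    with refl ← just-injective (trans (sym (mp (here refl))) (mq (here refl))) =
    graft-determined g h
      (greedy-injective mate (λ i → mp (there (there i))) (λ i → mq (there (there i))) (fresh-graft g f)
        (↭-trans p₁ (↭-trans (prep v (drop-∷ (drop-∷ (↭-trans (↭-sym q₁) (↭-trans p q₂))))) (↭-sym p₂))) G′ H′)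
      (Fresh.unique (fresh-graft g f))

  -- A tree for every matching

  cherry-∈ : Cherry a b t → a ∈ leaves t
  cherry-∈ (here (node leaf leaf)) = here refl
  cherry-∈ (here (swap leaf leaf)) = there (here refl)
  cherry-∈ (left c)                = ∈-++⁺ˡ (cherry-∈ c)
  cherry-∈ (right {l = l} c)       = ∈-++⁺ʳ (leaves l) (cherry-∈ c)

  ∈-range⁻ : ∀ v k → x ∈ range v k → v ≤ x × x < v + k
  ∈-range⁻ v (suc k) (here refl) = ≤-refl , m<m+n v (s≤s z≤n)
  ∈-range⁻ {x} v (suc k) (there x∈) with v<x , x< ← ∈-range⁻ (suc v) k x∈ =
    <⇒≤ v<x , subst (x <_) (sym (+-suc v k)) x<

  range-unique : ∀ v k → Unique (range v k)
  range-unique v zero    = []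
  range-unique v (suc k) = All.tabulate (λ x∈ → <⇒≢ (proj₁ (∈-range⁻ (suc v) k x∈))) ∷ range-unique (suc v) k

  length-range : ∀ v k → length (range v k) ≡ k
  length-range v zero    = refl
  length-range v (suc k) = cong suc (length-range (suc v) k)

  fresh-++-range : ∀ {xs} k → Fresh v xs → Unique (xs ++ range v k)
  fresh-++-range {v} k (fresh u lt) =
    Unique.++⁺ u (range-unique v k) λ (x∈ , x∈′) → <⇒≱ (All.lookup lt x∈) (proj₁ (∈-range⁻ v k x∈′))

  map-unique : {A B : Set} {f : A → B} (xs : List A) → (∀ {x y} → x ∈ xs → y ∈ xs → f x ≡ f y → x ≡ y) →
               Unique xs → Unique (map f xs)
  map-unique []       _   _        = []
  map-unique (x ∷ xs) inj (x≢ ∷ u) =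
    All.map⁺ (All.tabulate (λ y∈ eq → All.lookup x≢ y∈ (inj (here refl) (there y∈) eq))) ∷
    map-unique xs (λ x∈ y∈ → inj (there x∈) (there y∈)) u

  -- A matching of the labels in `xs`. With `m` defined on all numbers, one function serves while
  -- `xs` shrinks.
  record Pairing (m : ℕ → ℕ) (xs : List ℕ) : Set where
    field
      closed     : x ∈ xs → m x ∈ xs
      involutive : x ∈ xs → m (m x) ≡ x
      irrefl     : x ∈ xs → m x ≢ x

  module _ {m : ℕ → ℕ} where
    open Pairing

    pairing-resp-↭ : ∀ {xs ys} → xs ↭ ys → Pairing m xs → Pairing m ys
    pairing-resp-↭ p P = record
      { closed     = ∈-resp-↭ p ∘ closed P ∘ ∈-resp-↭ (↭-sym p)
      ; involutive = involutive P ∘ ∈-resp-↭ (↭-sym p)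
      ; irrefl     = irrefl P ∘ ∈-resp-↭ (↭-sym p)
      }

    pairing-remove : ∀ {xs} → Unique (a ∷ b ∷ xs) → m a ≡ b → Pairing m (a ∷ b ∷ xs) → Pairing m xs
    pairing-remove {xs = xs} (( _ ∷ a≢) ∷ b≢ ∷ _) refl P = record
      { closed     = closed′
      ; involutive = λ x∈ → involutive P (there (there x∈))
      ; irrefl     = λ x∈ → irrefl P (there (there x∈))
      }
      where
      closed′ : x ∈ xs → m x ∈ xs
      closed′ x∈ with closed P (there (there x∈)) | involutive P (there (there x∈))
      ... | there (there mx∈) | _ = mx∈
      ... | here mx≡a | eq = contradiction (trans (cong m (sym mx≡a)) eq) (All.lookup b≢ x∈)
      ... | there (here mx≡b) | eq =
        contradiction (trans (trans (sym (involutive P (here refl))) (cong m (sym mx≡b))) eq) (All.lookup a≢ x∈)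

    contract-↭ : ∀ {xs zs ys} → xs ↭ a ∷ b ∷ zs → xs ++ v ∷ ys ↭ a ∷ b ∷ v ∷ zs ++ ys
    contract-↭ {a} {b} {v} {zs = zs} p = ↭-trans (++⁺ʳ _ p) (prep a (prep b (shift v zs _)))

    least-internal-pair : ∀ k v xs → length xs ≡ 3 + k → Fresh v xs → Pairing m (xs ++ range v (suc k)) →
                          ∃[ a ] a ∈ xs × m a ∈ xs × (∀ {x} → x ∈ xs → m x ∈ xs → a ≤ x)
    least-internal-pair k v xs len f P
      with filter (λ x → m x ∈? xs) xs in eq
    ... | c ∷ cs =
      let a∈ , ma∈ = ∈-filter⁻ (λ x → m x ∈? xs) (subst (min c cs ∈_) (sym eq) min∈) in
      min c cs , a∈ , ma∈ , λ x∈ mx∈ → min≤ (subst (_ ∈_) eq (∈-filter⁺ (λ x → m x ∈? xs) x∈ mx∈))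
      where
      min∈ : min c cs ∈ c ∷ cs
      min∈ = [ (λ e → here e) , there ]′ (argmin-sel id c cs)
      min≤ : ∀ {x} → x ∈ c ∷ cs → min c cs ≤ x
      min≤ (here refl) = min≤v⁺ c cs (inj₁ ≤-refl)
      min≤ (there x∈)  = min≤v⁺ c cs (inj₂ (lose x∈ ≤-refl))
    -- If no label of `xs` had its mate in `xs`, then `m` would inject `3 + k` labels into the
    -- `1 + k` labels from `v` on.
    ... | [] = contradiction (Unique-⊆⇒length≤ unique escapes)
                 (<⇒≱ (subst₂ _<_ (sym (length-range v (suc k))) (sym (trans (length-map m xs) len))
                   (m≤n⇒m≤1+n ≤-refl)))
      where
      inj : ∀ {x y} → x ∈ xs → y ∈ xs → m x ≡ m y → x ≡ y
      inj x∈ y∈ e = trans (sym (involutive P (∈-++⁺ˡ x∈))) (trans (cong m e) (involutive P (∈-++⁺ˡ y∈)))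
      unique : Unique (map m xs)
      unique = map-unique xs inj (Fresh.unique f)
      escapes : ∀ {y} → y ∈ map m xs → y ∈ range v (suc k)
      escapes y∈ with x , x∈ , refl ← ∈-map⁻ m y∈ with ∈-++⁻ xs (closed P (∈-++⁺ˡ x∈))
      ... | inj₂ mx∈ = mx∈
      ... | inj₁ mx∈ with () ← subst (x ∈_) eq (∈-filter⁺ (λ x → m x ∈? xs) x∈ mx∈)

    -- The least pair of mates within `xs` is replaced by `v`, the induction gives a tree for the
    -- remaining labels, and its leaf `v` sprouts that pair as a cherry.
    greedy-realises : ∀ k v xs → length xs ≡ 2 + k → Fresh v xs → Pairing m (xs ++ range v k) →
                      ∃[ t ] ∃[ ps ] Greedy v k t ps × leaves t ↭ xs × (∀ {x y} → (x , y) ∈ arcs ps → m x ≡ y)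
    greedy-realises zero v (a ∷ b ∷ []) _ f P = node (leaf a) (leaf b) , _ , root ≅-refl , ↭-refl , λ where
        (here refl)         → ma≡b
        (there (here refl)) → trans (cong m (sym ma≡b)) (involutive P (here refl))
      where
      ma≡b : m a ≡ b
      ma≡b with closed P (here refl)
      ... | here eq         = contradiction eq (irrefl P (here refl))
      ... | there (here eq) = eq
    greedy-realises (suc k) v xs len f P
      with a , a∈ , b∈ , least ← least-internal-pair k v xs len f P
      with ys , p ← ∈⇒↭ a∈
      with ∈-resp-↭ p b∈
    ... | here b≡a = contradiction b≡a (irrefl P (∈-++⁺ˡ a∈))
    ... | there b∈ys
      with zs , q ← ∈⇒↭ b∈ys
      with p′ ← ↭-trans p (prep a q)
      with s , ps , G , leaves-s , arcs-s ← greedy-realises k (suc v) (v ∷ zs)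
             (suc-injective (trans (sym (↭-length p′)) len))
             (fresh-step (fresh-resp-↭ p′ f))
             (pairing-remove {a = a} {m a}
               (Unique-resp-↭ (contract-↭ p′) (fresh-++-range (suc k) f)) refl
               (pairing-resp-↭ (contract-↭ p′) P))
      with t , g ← leaf⇒graft a (m a) s (∈-resp-↭ (↭-sym leaves-s) (here refl))
      with zs′ , r , r′ ← graft-leaves g =
      t , (a , m a) ∷ ps , step g a<b least′ G , leaves-t , arcs-t
      where
      mb≡a : m (m a) ≡ a
      mb≡a = involutive P (∈-++⁺ˡ a∈)
      a<b : a < m a
      a<b = ≤∧≢⇒< (least b∈ (subst (_∈ xs) (sym mb≡a) a∈)) (irrefl P (∈-++⁺ˡ a∈) ∘ sym)
      leaves-t : leaves t ↭ xs
      leaves-t = ↭-trans r′ (↭-trans (prep a (prep (m a) (drop-∷ (↭-trans (↭-sym r) leaves-s)))) (↭-sym p′))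
      -- A cherry of `t` is the grafted one or an arc of the run for `s`, so it consists of mates.
      -- Minimality of `a` among mates thus becomes minimality among cherries.
      mates : ∀ {x y} → Cherry x y t → m x ≡ y
      mates c with cherry-graft⁻ g c
      ... | inj₁ (refl , refl)        = refl
      ... | inj₂ (inj₁ (refl , refl)) = mb≡a
      ... | inj₂ (inj₂ d)             = arcs-s (greedy-cherry⇒arc G d)
      least′ : ∀ {x y} → Cherry x y t → a ≤ x
      least′ c = least (∈-resp-↭ leaves-t (cherry-∈ c))
        (subst (_∈ xs) (sym (mates c)) (∈-resp-↭ leaves-t (cherry-∈ (cherry-sym c))))
      arcs-t : ∀ {x y} → (x , y) ∈ arcs ((a , m a) ∷ ps) → m x ≡ y
      arcs-t (here refl)         = refl
      arcs-t (there (here refl)) = mb≡a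
      arcs-t (there (there i))   = arcs-s i

  -- The labelling follows the contraction

  -- The counterpart of `initial` for labels in ℕ, since contracted trees have leaves labelled from
  -- `n` on.
  start : Tree ℕ → Partial
  start (leaf a)   = leaf a
  start (node l r) = node nothing (start l) (start r)

  -- The labelling keeps the cherry below a vertex labelled `v` where the contracted tree has the
  -- leaf `v`. Partial trees are plane, hence the two base cases.
  data GraftP (v a b : ℕ) : Partial → Partial → Set where
    here  : GraftP v a b (leaf v) (node (just v) (leaf a) (leaf b))
    here′ : GraftP v a b (leaf v) (node (just v) (leaf b) (leaf a))
    left  : ∀ {m l l′ r} → GraftP v a b l l′ → GraftP v a b (node m l r) (node m l′ r)
    right : ∀ {m l r r′} → GraftP v a b r r′ → GraftP v a b (node m l r) (node m l r′)

  assign-hit : ∀ m l r → key (node m l r) ≡ just c →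
               assign c v (node m l r) ≡ node (just v) (assign c v l) (assign c v r)
  assign-hit {c} m l r eq rewrite dec-true (key (node m l r) ≟ᴹ just c) eq = refl

  assign-miss : ∀ m l r → key (node m l r) ≢ just c →
                assign c v (node m l r) ≡ node m (assign c v l) (assign c v r)
  assign-miss {c} m l r neq rewrite dec-false (key (node m l r) ≟ᴹ just c) neq = refl

  graftP-label : GraftP v a b T U → label T ≡ label U
  graftP-label here      = refl
  graftP-label here′     = refl
  graftP-label (left _)  = refl
  graftP-label (right _) = refl

  key-cong : ∀ m {l l′ r r′} → label l ≡ label l′ → label r ≡ label r′ → key (node m l r) ≡ key (node m l′ r′)
  key-cong nothing  p q = cong₂ (zipWith _⊓_) p q
  key-cong (just _) p q = refl

  graftP-keys : GraftP v a b T U → keys T ≡ keys U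
  graftP-keys here  = refl
  graftP-keys here′ = refl
  graftP-keys (left {m} {r = r} g) =
    cong₂ (λ x y → fromMaybe x ++ (y ++ keys r)) (key-cong m (graftP-label g) refl) (graftP-keys g)
  graftP-keys (right {m} {l} g) =
    cong₂ (λ x y → fromMaybe x ++ (keys l ++ y)) (key-cong m refl (graftP-label g)) (graftP-keys g)

  graftP-assign : ∀ c w → GraftP v a b T U → GraftP v a b (assign c w T) (assign c w U)
  graftP-assign c w here  = here
  graftP-assign c w here′ = here′
  graftP-assign c w (left {m} {l} {l′} {r} g)
    rewrite key-cong m {l} {l′} {r} (graftP-label g) refl = left (graftP-assign c w g)
  graftP-assign c w (right {m} {l} {r} {r′} g)
    rewrite key-cong m {l} {l} {r} {r′} refl (graftP-label g) = right (graftP-assign c w g)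

  graftP-round : ∀ w → GraftP v a b T U → GraftP v a b (round T w) (round U w)
  graftP-round w here  = here
  graftP-round w here′ = here′
  graftP-round w (left {m} {l} {l′} {r} g) rewrite graftP-keys g with least (keys l′ ++ keys r)
  ... | nothing = left g
  ... | just c  = left (graftP-assign c w g)
  graftP-round w (right {m} {l} {r} {r′} g) rewrite graftP-keys g with least (keys l ++ keys r′)
  ... | nothing = right g
  ... | just c  = right (graftP-assign c w g)

  -- Labelled vertices expose no keys, so later rounds act alike on both sides.
  graftP-rounds : ∀ ws → GraftP v a b T U → GraftP v a b (foldl round T ws) (foldl round U ws)
  graftP-rounds []       g = g
  graftP-rounds (w ∷ ws) g = graftP-rounds ws (graftP-round w g)

  -- At the start every key is the label of a leaf, so a `c` absent from the leaves hits no vertex.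
  assign-fresh : ∀ v (s : Tree ℕ) → c ∉ leaves s → assign c v (start s) ≡ start s
  assign-fresh v (leaf a) _ = refl
  assign-fresh {c} v (node l r) c∉ = trans (assign-miss nothing (start l) (start r) (miss l r c∉))
    (cong₂ (node nothing) (assign-fresh v l (c∉ ∘ ∈-++⁺ˡ)) (assign-fresh v r (c∉ ∘ ∈-++⁺ʳ (leaves l))))
    where
    miss : ∀ l r → c ∉ leaves (node l r) → key (start (node l r)) ≢ just c
    miss (leaf a) (leaf b) c∉ eq with ⊓-sel a b
    ... | inj₁ a⊓b≡a = c∉ (here (trans (sym (just-injective eq)) a⊓b≡a))
    ... | inj₂ a⊓b≡b = c∉ (there (here (trans (sym (just-injective eq)) a⊓b≡b)))
    miss (leaf _)   (node _ _) _ ()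
    miss (node _ _) (leaf _)   _ ()
    miss (node _ _) (node _ _) _ ()

  graft-unlabelled : Graft v a b s t → label (start t) ≡ nothing
  graft-unlabelled (here (node leaf leaf)) = refl
  graft-unlabelled (here (swap leaf leaf)) = refl
  graft-unlabelled (left _)  = refl
  graft-unlabelled (right _) = refl

  -- Only the vertex of the cherry has the key `a`: the vertices above it have an unlabelled child
  -- and hence no key, and the subtrees beside it do not contain `a`.
  graft-assign : Graft v a b s t → a < b → Unique (leaves t) → GraftP v a b (start s) (assign a v (start t))
  graft-assign {v} {a} {b} (here (node leaf leaf)) a<b _ = subst (GraftP v a b (leaf v))
    (sym (assign-hit nothing (leaf a) (leaf b) (cong just (m≤n⇒m⊓n≡m (<⇒≤ a<b))))) here
  graft-assign {v} {a} {b} (here (swap leaf leaf)) a<b _ = subst (GraftP v a b (leaf v))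
    (sym (assign-hit nothing (leaf b) (leaf a) (cong just (m≥n⇒m⊓n≡n (<⇒≤ a<b))))) here′
  graft-assign {v} {a} {b} (left {l} {s} {r} g) a<b u with u₁ , _ , disjoint ← Unique-++⁻ (leaves s) u =
    subst (GraftP v a b (start (node l r)))
      (sym (trans (assign-miss nothing (start s) (start r) miss)
        (cong (node nothing _) (assign-fresh v r (disjoint (cherry-∈ (graft⇒cherry g)))))))
      (left (graft-assign g a<b u₁))
    where
    miss : zipWith _⊓_ (label (start s)) (label (start r)) ≢ just a
    miss eq rewrite graft-unlabelled g with () ← eq
  graft-assign {v} {a} {b} (right {r} {s} {l} g) a<b u with _ , u₂ , disjoint ← Unique-++⁻ (leaves l) u =
    subst (GraftP v a b (start (node l r)))
      (sym (trans (assign-miss nothing (start l) (start s) miss)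
        (cong (λ m → node nothing m _) (assign-fresh v l (λ a∈ → disjoint a∈ (cherry-∈ (graft⇒cherry g)))))))
      (right (graft-assign g a<b u₂))
    where
    miss : zipWith _⊓_ (label (start l)) (label (start s)) ≢ just a
    miss eq rewrite graft-unlabelled g with label (start l) | eq
    ... | just _  | ()
    ... | nothing | ()

  keys⇒cherry : ∀ t → c ∈ keys (start t) → ∃[ x ] ∃[ y ] Cherry x y t × c ≡ x ⊓ y
  keys⇒cherry (node l r) c∈ with ∈-++⁻ (fromMaybe (key (start (node l r)))) c∈
  ... | inj₂ c∈lr = [ (λ c∈l → let x , y , d , e = keys⇒cherry l c∈l in x , y , left d , e)
                    , (λ c∈r → let x , y , d , e = keys⇒cherry r c∈r in x , y , right d , e) ]′
                    (∈-++⁻ (keys (start l)) c∈lr)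
  keys⇒cherry (node (leaf a) (leaf b)) _ | inj₁ (here refl) = a , b , here ≅-refl , refl

  cherry⇒keys : Cherry a b t → a < b → a ∈ keys (start t)
  cherry⇒keys (here (node leaf leaf)) a<b = here (sym (m≤n⇒m⊓n≡m (<⇒≤ a<b)))
  cherry⇒keys (here (swap leaf leaf)) a<b = here (sym (m≥n⇒m⊓n≡n (<⇒≤ a<b)))
  cherry⇒keys {t = node l r} (left c)  a<b =
    ∈-++⁺ʳ (fromMaybe (key (start (node l r)))) (∈-++⁺ˡ (cherry⇒keys c a<b))
  cherry⇒keys {t = node l r} (right c) a<b =
    ∈-++⁺ʳ (fromMaybe (key (start (node l r)))) (∈-++⁺ʳ (keys (start l)) (cherry⇒keys c a<b))

  least-just : ∀ {xs} → a ∈ xs → (∀ {c} → c ∈ xs → a ≤ c) → least xs ≡ just a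
  least-just {a} {x ∷ xs} a∈ lower = cong just (≤-antisym (upper a∈)
    (v≤min⁺ (lower (here refl)) (All.tabulate (lower ∘ there))))
    where
    upper : a ∈ x ∷ xs → min x xs ≤ a
    upper (here refl) = min≤v⁺ x xs (inj₁ ≤-refl)
    upper (there a∈)  = min≤v⁺ x xs (inj₂ (lose a∈ ≤-refl))

  -- `round` searches only below the root, so the cherry has to lie in one of the two subtrees.
  least-keys : (∀ {x y} → Cherry x y (node l r) → a ≤ x) → Cherry a b l ⊎ Cherry a b r → a < b →
               least (keys (start l) ++ keys (start r)) ≡ just a
  least-keys {l} {r} lower c a<b = least-just
    ([ (λ d → ∈-++⁺ˡ (cherry⇒keys d a<b)) , (λ d → ∈-++⁺ʳ (keys (start l)) (cherry⇒keys d a<b)) ]′ c)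
    λ c∈ → let _ , _ , d , e = keys⇒cherry (node l r) (∈-++⁺ʳ (fromMaybe (key (start (node l r)))) c∈)
           in subst (_ ≤_) (sym e) (⊓-glb (lower d) (lower (cherry-sym d)))

  -- That the contracted tree is a node places the cherry strictly below the root, the vertex that
  -- `round` never labels.
  graft-round : ∀ {l′ r′} → Graft v a b (node l′ r′) t → a < b → (∀ {x y} → Cherry x y t → a ≤ x) → Unique (leaves t) →
                GraftP v a b (start (node l′ r′)) (round (start t) v)
  graft-round {v} (left {l} {s} {r} g) a<b lower u with u₁ , _ , disjoint ← Unique-++⁻ (leaves s) u
    rewrite least-keys lower (inj₁ (graft⇒cherry g)) a<b
          | assign-fresh v r (disjoint (cherry-∈ (graft⇒cherry g))) = left (graft-assign g a<b u₁)
  graft-round {v} (right {r} {s} {l} g) a<b lower u with _ , u₂ , disjoint ← Unique-++⁻ (leaves l) u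
    rewrite least-keys lower (inj₂ (graft⇒cherry g)) a<b
          | assign-fresh v l (λ a∈ → disjoint a∈ (cherry-∈ (graft⇒cherry g))) = right (graft-assign g a<b u₂)

  -- Siblings in the finished labelling

  -- The ends of a contracted cherry never return in the contracted tree, so a search for them
  -- succeeds only at the graft.
  Avoids : ℕ → Partial → Set
  Avoids x (leaf a)     = a ≢ x
  Avoids x (node m l r) = m ≢ just x × Avoids x l × Avoids x r

  avoids-label : ∀ T → Avoids x T → label T ≢ just x
  avoids-label (leaf a)     a≢x       refl = a≢x refl
  avoids-label (node m l r) (m≢x , _) = m≢x

  avoids-start : ∀ t → x ∉ leaves t → Avoids x (start t)
  avoids-start (leaf a)   x∉ a≡x = x∉ (here (sym a≡x))
  avoids-start (node l r) x∉ = (λ ()) , avoids-start l (x∉ ∘ ∈-++⁺ˡ) , avoids-start r (x∉ ∘ ∈-++⁺ʳ (leaves l))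

  avoids-assign : ∀ c → v ≢ x → ∀ T → Avoids x T → Avoids x (assign c v T)
  avoids-assign c v≢x (leaf a) ok = ok
  avoids-assign {v} {x} c v≢x T@(node m l r) (m≢ , okl , okr) =
    new , avoids-assign c v≢x l okl , avoids-assign c v≢x r okr
    where
    new : (if does (key T ≟ᴹ just c) then just v else m) ≢ just x
    new with does (key T ≟ᴹ just c)
    ... | true  = v≢x ∘ just-injective
    ... | false = m≢

  avoids-round : v ≢ x → ∀ T → Avoids x T → Avoids x (round T v)
  avoids-round v≢x (leaf a) ok = ok
  avoids-round v≢x (node m l r) ok@(m≢ , okl , okr) with least (keys l ++ keys r)
  ... | nothing = ok
  ... | just c  = m≢ , avoids-assign c v≢x l okl , avoids-assign c v≢x r okr

  avoids-rounds : ∀ vs → x ∉ vs → ∀ T → Avoids x T → Avoids x (foldl round T vs)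
  avoids-rounds []       _  T ok = ok
  avoids-rounds (v ∷ vs) x∉ T ok =
    avoids-rounds vs (x∉ ∘ there) (round T v) (avoids-round (λ v≡x → x∉ (here (sym v≡x))) T ok)

  sibling-left : ∀ m l r → label l ≡ just x → sibling (node m l r) x ≡ label r
  sibling-left {x} m l r eq rewrite dec-true (label l ≟ᴹ just x) eq = refl

  sibling-right : ∀ m l r → label l ≢ just x → label r ≡ just x → sibling (node m l r) x ≡ label l
  sibling-right {x} m l r neq eq
    rewrite dec-false (label l ≟ᴹ just x) neq | dec-true (label r ≟ᴹ just x) eq = refl

  sibling-deep : ∀ m l r → label l ≢ just x → label r ≢ just x → sibling (node m l r) x ≡ (sibling l x <∣> sibling r x)
  sibling-deep {x} m l r neq neq′
    rewrite dec-false (label l ≟ᴹ just x) neq | dec-false (label r ≟ᴹ just x) neq′ = refl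

  sibling-leaves : ∀ m → a ≢ b →
                   sibling (node m (leaf a) (leaf b)) a ≡ just b × sibling (node m (leaf a) (leaf b)) b ≡ just a
  sibling-leaves {a} {b} m a≢b =
    sibling-left m (leaf a) (leaf b) refl , sibling-right m (leaf a) (leaf b) (a≢b ∘ just-injective) refl

  sibling-avoids : ∀ T → Avoids x T → sibling T x ≡ nothing
  sibling-avoids (leaf _)     _ = refl
  sibling-avoids {x} (node m l r) (_ , okl , okr)
    rewrite sibling-deep {x} m l r (avoids-label l okl) (avoids-label r okr) | sibling-avoids l okl =
    sibling-avoids r okr

  -- The two sides differ only by the cherry below `v`: a search for another label fails inside it,
  -- and the label seen from above is the same.
  graftP-sibling-old : x ≢ a → x ≢ b → GraftP v a b T U → sibling U x ≡ sibling T x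
  graftP-sibling-old x≢a x≢b here =
    sibling-deep nothing (leaf _) (leaf _) (x≢a ∘ sym ∘ just-injective) (x≢b ∘ sym ∘ just-injective)
  graftP-sibling-old x≢a x≢b here′ =
    sibling-deep nothing (leaf _) (leaf _) (x≢b ∘ sym ∘ just-injective) (x≢a ∘ sym ∘ just-injective)
  graftP-sibling-old x≢a x≢b (left g)
    rewrite graftP-label g | graftP-sibling-old x≢a x≢b g = refl
  graftP-sibling-old x≢a x≢b (right g)
    rewrite graftP-label g | graftP-sibling-old x≢a x≢b g = refl

  graftP-sibling-new : a ≢ b → Avoids x T → GraftP v a b T U → (x ≡ a × y ≡ b) ⊎ (x ≡ b × y ≡ a) → sibling U x ≡ just y
  graftP-sibling-new a≢b _ here  (inj₁ (refl , refl)) = proj₁ (sibling-leaves nothing a≢b)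
  graftP-sibling-new a≢b _ here  (inj₂ (refl , refl)) = proj₂ (sibling-leaves nothing a≢b)
  graftP-sibling-new a≢b _ here′ (inj₁ (refl , refl)) = proj₂ (sibling-leaves nothing (a≢b ∘ sym))
  graftP-sibling-new a≢b _ here′ (inj₂ (refl , refl)) = proj₁ (sibling-leaves nothing (a≢b ∘ sym))
  graftP-sibling-new a≢b (_ , okl , okr) (left {m} {l} {l′} {r} g) e = trans
    (sibling-deep m l′ r (avoids-label l okl ∘ trans (graftP-label g)) (avoids-label r okr))
    (cong (_<∣> sibling r _) (graftP-sibling-new a≢b okl g e))
  graftP-sibling-new a≢b (_ , okl , okr) (right {m} {l} {r} {r′} g) e = trans
    (sibling-deep m l r′ (avoids-label l okl) (avoids-label r okr ∘ trans (graftP-label g)))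
    (cong₂ _<∣>_ (sibling-avoids l okl) (graftP-sibling-new a≢b okr g e))

  greedy-node : Greedy v k t ps → ∃[ l ] ∃[ r ] t ≡ node l r
  greedy-node (root (node _ _)) = _ , _ , refl
  greedy-node (root (swap _ _)) = _ , _ , refl
  greedy-node (step (here (node _ _)) _ _ _) = _ , _ , refl
  greedy-node (step (here (swap _ _)) _ _ _) = _ , _ , refl
  greedy-node (step (left _) _ _ _)  = _ , _ , refl
  greedy-node (step (right _) _ _ _) = _ , _ , refl

  -- After the first round `GraftP` links the labelling of `t` to that of the contracted tree, and
  -- the later rounds preserve it. The siblings are therefore those of the contracted tree together
  -- with `a` and `b`.
  greedy-sibling : Greedy v k t ps → Fresh v (leaves t) → (x , y) ∈ arcs ps →
                   sibling (foldl round (start t) (range v k)) x ≡ just y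
  greedy-sibling (root (node leaf leaf)) (fresh ((a≢b ∷ []) ∷ _) _) (here refl)
    = proj₁ (sibling-leaves nothing a≢b)
  greedy-sibling (root (node leaf leaf)) (fresh ((a≢b ∷ []) ∷ _) _) (there (here refl))
    = proj₂ (sibling-leaves nothing a≢b)
  greedy-sibling (root (swap leaf leaf)) (fresh ((b≢a ∷ []) ∷ _) _) (here refl)
    = proj₂ (sibling-leaves nothing b≢a)
  greedy-sibling (root (swap leaf leaf)) (fresh ((b≢a ∷ []) ∷ _) _) (there (here refl))
    = proj₁ (sibling-leaves nothing b≢a)
  greedy-sibling {v} {suc k} {t} {x = x} {y} (step {a = a} {b} {s} {ps = ps} g a<b lower G) f arc
    with _ , _ , refl ← greedy-node G
    with grafted ← graftP-rounds (range (suc v) k) (graft-round g a<b lower (Fresh.unique f)) = go arc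
    where
    unique : Unique (a ∷ b ∷ ends ps)
    unique = Unique-resp-↭ (↭-sym (greedy-ends (step g a<b lower G))) (fresh-++-range (suc k) f)
    avoids : ∀ {x} → x ∉ ends ps → Avoids x (foldl round (start s) (range (suc v) k))
    avoids x∉ = avoids-rounds (range (suc v) k) (x∉ ∘ ∈-resp-↭ (↭-sym (greedy-ends G)) ∘ ∈-++⁺ʳ (leaves s)) (start s)
      (avoids-start s (x∉ ∘ ∈-resp-↭ (↭-sym (greedy-ends G)) ∘ ∈-++⁺ˡ))
    go : (x , y) ∈ arcs ((a , b) ∷ ps) → sibling (foldl round (round (start t) v) (range (suc v) k)) x ≡ just y
    go (here refl) =
      graftP-sibling-new (<⇒≢ a<b) (avoids (Unique[x∷xs]⇒x∉xs unique ∘ there)) grafted (inj₁ (refl , refl))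
    go (there (here refl)) =
      graftP-sibling-new (<⇒≢ a<b) (avoids (Unique[x∷xs]⇒x∉xs (AllPairs.tail unique))) grafted (inj₂ (refl , refl))
    go (there (there i)) = trans
      (graftP-sibling-old (λ { refl → Unique[x∷xs]⇒x∉xs unique (there (arcs-ends {ps = ps} i)) })
        (λ { refl → Unique[x∷xs]⇒x∉xs (AllPairs.tail unique) (arcs-ends {ps = ps} i) }) grafted)
      (greedy-sibling G (fresh-graft g f) i)

  -- Mixed pairs and single leaves

  module _ (n : ℕ) where

    mix : Bool → Bool → ℕ
    mix x y = if x xor y then 1 else 0

    -- Leaves n, n + 1, … stand for internal vertices.
    isLeaf : Tree ℕ → Bool
    isLeaf (leaf a)   = does (a <? n)
    isLeaf (node _ _) = false

    mixed : Tree ℕ → ℕ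
    mixed (leaf _)   = 0
    mixed (node l r) = mix (isLeaf l) (isLeaf r) + (mixed l + mixed r)

    Mixed? : (p : ℕ × ℕ) → Dec (proj₁ p < n × n ≤ proj₂ p)
    Mixed? p = (proj₁ p <? n) ×-dec (n ≤? proj₂ p)

    length-filter-∷ : ∀ p ps → length (filter Mixed? (p ∷ ps)) ≡
                      (if does (Mixed? p) then 1 else 0) + length (filter Mixed? ps)
    length-filter-∷ p ps with does (Mixed? p)
    ... | true  = refl
    ... | false = refl

    ≤?-not : ∀ a → does (n ≤? a) ≡ not (does (a <? n))
    ≤?-not a with a <? n
    ... | yes a<n = trans (dec-false (n ≤? a) (<⇒≱ a<n)) (cong not (sym (dec-true (a <? n) a<n)))
    ... | no a≮n  = trans (dec-true (n ≤? a) (≮⇒≥ a≮n)) (cong not (sym (dec-false (a <? n) a≮n)))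

    -- At most one orientation of a pair starts below `n` and ends from `n` on, and one does exactly
    -- when the two sides differ; hence the exclusive or.
    count-arcs : ∀ a b ps → length (filter Mixed? (arcs ((a , b) ∷ ps))) ≡
                 mix (does (a <? n)) (does (b <? n)) + length (filter Mixed? (arcs ps))
    count-arcs a b ps
      rewrite length-filter-∷ (a , b) ((b , a) ∷ arcs ps) | length-filter-∷ (b , a) (arcs ps) | ≤?-not a | ≤?-not b
      with does (a <? n) | does (b <? n)
    ... | true  | true  = refl
    ... | true  | false = refl
    ... | false | true  = refl
    ... | false | false = refl

    mix-comm : ∀ x y → mix x y ≡ mix y x
    mix-comm true  true  = refl
    mix-comm true  false = refl
    mix-comm false true  = refl
    mix-comm false false = refl

    mixed-cherry : t ≅ node (leaf a) (leaf b) → mixed t ≡ mix (does (a <? n)) (does (b <? n)) + 0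
    mixed-cherry (node leaf leaf) = refl
    mixed-cherry {a = a} {b} (swap leaf leaf) = cong (_+ 0) (mix-comm (does (b <? n)) (does (a <? n)))

    graft-isLeaf : n ≤ v → Graft v a b s t → isLeaf t ≡ isLeaf s
    graft-isLeaf {v} n≤v (here (node leaf leaf)) = sym (dec-false (v <? n) (≤⇒≯ n≤v))
    graft-isLeaf {v} n≤v (here (swap leaf leaf)) = sym (dec-false (v <? n) (≤⇒≯ n≤v))
    graft-isLeaf n≤v (left _)  = refl
    graft-isLeaf n≤v (right _) = refl

    -- With `n ≤ v` the new leaf still counts as an internal vertex for its sibling, so the
    -- contraction loses only the contribution of `a` and `b`.
    graft-mixed : n ≤ v → Graft v a b s t → mixed t ≡ mix (does (a <? n)) (does (b <? n)) + mixed s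
    graft-mixed n≤v (here e) = mixed-cherry e
    graft-mixed {a = a} {b} n≤v (left {l} {r = r} g) rewrite graft-isLeaf n≤v g | graft-mixed n≤v g =
      solve 4 (λ x m p q → m :+ ((x :+ p) :+ q) := x :+ (m :+ (p :+ q))) refl
        (mix (does (a <? n)) (does (b <? n))) (mix (isLeaf l) (isLeaf r)) (mixed l) (mixed r)
    graft-mixed {a = a} {b} n≤v (right {r} {l = l} g) rewrite graft-isLeaf n≤v g | graft-mixed n≤v g =
      solve 4 (λ x m p q → m :+ (p :+ (x :+ q)) := x :+ (m :+ (p :+ q))) refl
        (mix (does (a <? n)) (does (b <? n))) (mix (isLeaf l) (isLeaf r)) (mixed l) (mixed r)

    greedy-mixed : n ≤ v → Greedy v k t ps → length (filter Mixed? (arcs ps)) ≡ mixed t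
    greedy-mixed n≤v (root {a = a} {b} e) = trans (count-arcs a b []) (sym (mixed-cherry e))
    greedy-mixed n≤v (step {a = a} {b} {ps = ps} g _ _ G) = trans (count-arcs a b ps)
      (trans (cong₂ _+_ (refl {x = mix (does (a <? n)) (does (b <? n))}) (greedy-mixed (m≤n⇒m≤1+n n≤v) G))
        (sym (graft-mixed n≤v g)))

    singles-mixed : (t : Tree (Fin n)) → singles t ≡ mixed (relabel toℕ t)
    singles-mixed (leaf _)   = refl
    singles-mixed (node l r) = cong₂ _+_ (below l r) (cong₂ _+_ (singles-mixed l) (singles-mixed r))
      where
      isLeaf-leaf : (i : Fin n) → does (toℕ i <? n) ≡ true
      isLeaf-leaf i = dec-true (toℕ i <? n) (Fin.toℕ<n i)
      below : ∀ l r → singlesBelow l r ≡ mix (isLeaf (relabel toℕ l)) (isLeaf (relabel toℕ r))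
      below (leaf i)   (leaf j)   rewrite isLeaf-leaf i | isLeaf-leaf j = refl
      below (leaf i)   (node _ _) rewrite isLeaf-leaf i = refl
      below (node _ _) (leaf j)   rewrite isLeaf-leaf j = refl
      below (node _ _) (node _ _) = refl

  -- Between `Fin n` and ℕ

  initial-start : ∀ {n} (t : Tree (Fin n)) → initial t ≡ start (relabel toℕ t)
  initial-start (leaf _)   = refl
  initial-start (node l r) = cong₂ (node nothing) (initial-start l) (initial-start r)

  leaves-relabel : {A B : Set} (f : A → B) (t : Tree A) → leaves (relabel f t) ≡ map f (leaves t)
  leaves-relabel f (leaf _)   = refl
  leaves-relabel f (node l r) =
    trans (cong₂ _++_ (leaves-relabel f l) (leaves-relabel f r)) (sym (map-++ f (leaves l) (leaves r)))

  relabel-≅ : {A B : Set} (f : A → B) {s t : Tree A} → s ≅ t → relabel f s ≅ relabel f t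
  relabel-≅ f leaf       = leaf
  relabel-≅ f (node p q) = node (relabel-≅ f p) (relabel-≅ f q)
  relabel-≅ f (swap p q) = swap (relabel-≅ f p) (relabel-≅ f q)

  relabel-≅⁻ : {A B : Set} {f : A → B} → (∀ {x y} → f x ≡ f y → x ≡ y) → (s t : Tree A) →
               relabel f s ≅ relabel f t → s ≅ t
  relabel-≅⁻ {f = f} inj (leaf x) (leaf y) e = subst (λ z → leaf x ≅ leaf z) (inj (label≡ e)) leaf
    where
    label≡ : ∀ {x y} → leaf x ≅ leaf y → x ≡ y
    label≡ leaf = refl
  relabel-≅⁻ inj (node l r) (node l′ r′) (node p q) = node (relabel-≅⁻ inj l l′ p) (relabel-≅⁻ inj r r′ q)
  relabel-≅⁻ inj (node l r) (node l′ r′) (swap p q) = swap (relabel-≅⁻ inj l r′ p) (relabel-≅⁻ inj r l′ q)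

  relabel-toℕ⁻ : ∀ {n} (t : Tree ℕ) → All (_< n) (leaves t) → ∃[ u ] relabel {Fin n} toℕ u ≡ t
  relabel-toℕ⁻ (leaf a) (a<n ∷ []) = leaf (fromℕ< a<n) , cong leaf (Fin.toℕ-fromℕ< a<n)
  relabel-toℕ⁻ (node l r) lt with lt₁ , lt₂ ← All.++⁻ (leaves l) lt
    with u , refl ← relabel-toℕ⁻ l lt₁ | v , refl ← relabel-toℕ⁻ r lt₂ = node u v , refl

  range-upTo : ∀ v k → map (λ i → v + i) (upTo k) ≡ range v k
  range-upTo v k = trans (map-upTo (λ i → v + i) k) (go (λ i → v + i) v k (λ _ → refl))
    where
    go : ∀ (f : ℕ → ℕ) v k → (∀ i → f i ≡ v + i) → applyUpTo f k ≡ range v k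
    go f v zero    _  = refl
    go f v (suc k) eq =
      cong₂ _∷_ (trans (eq 0) (+-identityʳ v)) (go (f ∘ suc) (suc v) k (λ i → trans (eq (suc i)) (+-suc v i)))

  toℕs-unique : ∀ N → Unique (map toℕ (allFin N))
  toℕs-unique N = Unique.map⁺ Fin.toℕ-injective (allFin⁺ N)

  ∈-toℕs : ∀ {N x} → x < N → x ∈ map toℕ (allFin N)
  ∈-toℕs {N} x<N = subst (_∈ map toℕ (allFin N)) (Fin.toℕ-fromℕ< x<N) (∈-map⁺ toℕ (∈-allFin (fromℕ< x<N)))

  length-toℕs : ∀ N → length (map toℕ (allFin N)) ≡ N
  length-toℕs N = trans (length-map toℕ (allFin N)) (length-tabulate {n = N} id)

  -- Makes a matching total on ℕ, as `Pairing` requires; the identity is the default from `N` on.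
  extend : ∀ {N} → (Fin N → Fin N) → ℕ → ℕ
  extend {N} m x with x <? N
  ... | yes x<N = toℕ (m (fromℕ< x<N))
  ... | no _    = x

  extend-toℕ : ∀ {N} (m : Fin N → Fin N) i → extend m (toℕ i) ≡ toℕ (m i)
  extend-toℕ {N} m i with toℕ i <? N
  ... | yes i<N = cong (toℕ ∘ m) (Fin.fromℕ<-toℕ i i<N)
  ... | no i≮N  = contradiction (Fin.toℕ<n i) i≮N

  extend-pairing : ∀ {N} {m : Fin N → Fin N} → IsMatching m → Pairing (extend m) (map toℕ (allFin N))
  extend-pairing {N} {m} isM = record
    { closed = λ x∈ → let i , _ , eq = ∈-map⁻ toℕ x∈ in
        subst (_∈ map toℕ (allFin N)) (sym (trans (cong m̂ eq) (extend-toℕ m i))) (∈-map⁺ toℕ (∈-allFin (m i)))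
    ; involutive = λ x∈ → let i , _ , eq = ∈-map⁻ toℕ x∈ in
        trans (cong (m̂ ∘ m̂) eq) (trans (cong m̂ (extend-toℕ m i)) (trans (extend-toℕ m (m i))
          (trans (cong toℕ (involutive i)) (sym eq))))
    ; irrefl = λ x∈ e → let i , _ , eq = ∈-map⁻ toℕ x∈ in
        fixedPointFree i (Fin.toℕ-injective (trans (sym (extend-toℕ m i)) (trans (cong m̂ (sym eq)) (trans e eq))))
    }
    where
    open IsMatching isM
    m̂ = extend m

  toℕs-fresh : ∀ n → Fresh n (map toℕ (allFin n))
  toℕs-fresh n = fresh (toℕs-unique n) (All.map⁺ (All.tabulate (λ {i} _ → Fin.toℕ<n i)))

  -- The bijection given by Ψ

  module _ (n k : ℕ) (2≤n : 2 ≤ n) where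
    open BinaryTree
    open Matching

    private
      N = 2 * n ∸ 2

    N≡ : n + (n ∸ 2) ≡ N
    N≡ = trans (sym (+-∸-assoc n 2≤n)) (cong (λ m → n + m ∸ 2) (sym (+-identityʳ n)))

    n≡ : n ≡ 2 + (n ∸ 2)
    n≡ = sym (m+[n∸m]≡n 2≤n)

    all-labels : ∀ {xs} → Fresh n xs → length xs ≡ n → xs ++ range n (n ∸ 2) ↭ map toℕ (allFin N)
    all-labels {xs} f len = Unique-⊆-length⇒↭ (fresh-++-range (n ∸ 2) f) bounded
      (trans (length-++ xs) (trans (cong₂ _+_ len (length-range n (n ∸ 2))) (trans N≡ (sym (length-toℕs N)))))
      where
      bounded : ∀ {x} → x ∈ xs ++ range n (n ∸ 2) → x ∈ map toℕ (allFin N)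
      bounded {x} x∈ with ∈-++⁻ xs x∈
      ... | inj₁ x∈xs = ∈-toℕs (<-≤-trans (All.lookup (Fresh.below f) x∈xs) (subst (n ≤_) N≡ (m≤m+n n (n ∸ 2))))
      ... | inj₂ x∈r  = ∈-toℕs (subst (x <_) N≡ (proj₂ (∈-range⁻ n (n ∸ 2) x∈r)))

    module _ (t : Tree (Fin n)) (len : length (leaves t) ≡ n) (u : Unique (leaves t)) where

      relabelled-length : length (leaves (relabel toℕ t)) ≡ n
      relabelled-length = trans (cong length (leaves-relabel toℕ t)) (trans (length-map toℕ (leaves t)) len)

      relabelled-fresh : Fresh n (leaves (relabel toℕ t))
      relabelled-fresh = subst (Fresh n) (sym (leaves-relabel toℕ t))
        (fresh (Unique.map⁺ Fin.toℕ-injective u) (All.map⁺ (All.tabulate (λ {i} _ → Fin.toℕ<n i))))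

      Ψ-greedy : ∃[ ps ] Greedy n (n ∸ 2) (relabel toℕ t) ps
      Ψ-greedy = greedy-exists (n ∸ 2) n (relabel toℕ t) (trans relabelled-length n≡) relabelled-fresh

      -- Any greedy run is allowed, not only that of `Ψ-greedy`: `Ψ-to-cong` uses one transported
      -- along `_≅_`, and `Ψ-from` one built from a matching.
      module _ {ps : List (ℕ × ℕ)} (G : Greedy n (n ∸ 2) (relabel toℕ t) ps) where

        Ψ-arc : ∀ {x y} → (x , y) ∈ arcs ps → Ψ t x ≡ just y
        Ψ-arc {x} arc = trans
          (cong₂ (λ T vs → sibling (foldl round T vs) x) (initial-start t) (range-upTo n (n ∸ 2)))
          (greedy-sibling G relabelled-fresh arc)

        ends↭ : ends ps ↭ map toℕ (allFin N)
        ends↭ = ↭-trans (greedy-ends G) (all-labels relabelled-fresh relabelled-length)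

        toℕ∈ends : (i : Fin N) → toℕ i ∈ ends ps
        toℕ∈ends i = ∈-resp-↭ (↭-sym ends↭) (∈-map⁺ toℕ (∈-allFin i))

        arc-from : (i : Fin N) → ∃[ j ] (toℕ i , toℕ {N} j) ∈ arcs ps
        arc-from i
          with y , arc ← ends-arcs {ps = ps} (toℕ∈ends i)
          with j , _ , refl ← ∈-map⁻ toℕ (∈-resp-↭ ends↭ (arcs-ends {ps = ps} (arcs-sym ps arc))) = j , arc

        -- `mixedPairs` counts over points and `greedy-mixed` over arcs. The graph of `m` consists
        -- of arcs and is as long as `arcs ps`, so the two lists agree up to order.
        Ψ-mixed : (m : Fin N → Fin N) → (∀ i → Ψ t (toℕ i) ≡ just (toℕ (m i))) → mixedPairs n m ≡ singles t
        Ψ-mixed m Ψm = begin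
          mixedPairs n m                                       ≡⟨ length-map g (filter (Mixed? n ∘ g) (allFin N)) ⟨
          length (map g (filter (Mixed? n ∘ g) (allFin N)))    ≡⟨ cong length (map-filter (allFin N)) ⟩
          length (filter (Mixed? n) (map g (allFin N)))        ≡⟨ ↭-length (filter-↭ (Mixed? n) graph↭) ⟩
          length (filter (Mixed? n) (arcs ps))                 ≡⟨ greedy-mixed n ≤-refl G ⟩
          mixed n (relabel toℕ t)                              ≡⟨ singles-mixed n t ⟨
          singles t                                            ∎
          where
          open ≡-Reasoning
          g : Fin N → ℕ × ℕ
          g i = toℕ i , toℕ (m i)
          map-filter : ∀ is → map g (filter (Mixed? n ∘ g) is) ≡ filter (Mixed? n) (map g is)
          map-filter []       = refl
          map-filter (i ∷ is) with does (Mixed? n (g i))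
          ... | true  = cong (g i ∷_) (map-filter is)
          ... | false = map-filter is
          graph⊆ : ∀ {p} → p ∈ map g (allFin N) → p ∈ arcs ps
          graph⊆ p∈ with i , _ , refl ← ∈-map⁻ g p∈ with y , arc ← ends-arcs {ps = ps} (toℕ∈ends i)
            with refl ← just-injective (trans (sym (Ψm i)) (Ψ-arc arc)) = arc
          graph↭ : map g (allFin N) ↭ arcs ps
          graph↭ = Unique-⊆-length⇒↭ (Unique.map⁺ (Fin.toℕ-injective ∘ cong proj₁) (allFin⁺ N)) graph⊆
            (trans (length-map g (allFin N)) (trans (sym (length-map toℕ (allFin N)))
              (trans (sym (↭-length ends↭)) (length-map proj₁ (arcs ps)))))

        Ψ-matching : ∃[ m ] IsMatching m × (∀ i → Ψ t (toℕ i) ≡ just (toℕ (m i)))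
        Ψ-matching = m , record { involutive = m-involutive ; fixedPointFree = m-irrefl } , λ i → Ψ-arc (m-arc i)
          where
          m = proj₁ ∘ arc-from
          m-arc : ∀ i → (toℕ i , toℕ (m i)) ∈ arcs ps
          m-arc = proj₂ ∘ arc-from
          m-involutive : ∀ i → m (m i) ≡ i
          m-involutive i = Fin.toℕ-injective (just-injective
            (trans (sym (Ψ-arc (m-arc (m i)))) (Ψ-arc (arcs-sym ps (m-arc i)))))
          m-irrefl : ∀ i → m i ≢ i
          m-irrefl i eq = arcs-irrefl ps (Unique-resp-↭ (↭-sym ends↭) (toℕs-unique N)) (m-arc i) (cong toℕ (sym eq))

    greedy : (t : BinaryTree n k) → ∃[ ps ] Greedy n (n ∸ 2) (relabel toℕ (tree t)) ps
    greedy t = Ψ-greedy (tree t) (n-leaves t) (distinct t)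

    Ψ-to : BinaryTree n k → Matching n k
    Ψ-to t = record
      { mate       = proj₁ M
      ; isMatching = proj₁ (proj₂ M)
      ; k-mixed    = trans
          (Ψ-mixed (tree t) (n-leaves t) (distinct t) (proj₂ (greedy t)) (proj₁ M) (proj₂ (proj₂ M))) (k-single t)
      }
      where M = Ψ-matching (tree t) (n-leaves t) (distinct t) (proj₂ (greedy t))

    Ψ-to-correct : ∀ t i → Ψ (tree t) (toℕ i) ≡ just (toℕ (mate (Ψ-to t) i))
    Ψ-to-correct t = proj₂ (proj₂ (Ψ-matching (tree t) (n-leaves t) (distinct t) (proj₂ (greedy t))))

    Ψ-to-determined : ∀ t (m : Fin N → Fin N) → (∀ i → Ψ (tree t) (toℕ i) ≡ just (toℕ (m i))) →
                      ∀ i → mate (Ψ-to t) i ≡ m i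
    Ψ-to-determined t m Ψm i = Fin.toℕ-injective (just-injective (trans (sym (Ψ-to-correct t i)) (Ψm i)))

    -- The run for `s` is also a run for `t` with the same arcs, so both values of Ψ are read off
    -- one arc.
    Ψ-to-cong : ∀ {s t} → tree s ≅ tree t → ∀ i → mate (Ψ-to s) i ≡ mate (Ψ-to t) i
    Ψ-to-cong {s} {t} e = Ψ-to-determined s (mate (Ψ-to t)) λ i →
      let y , arc = arc-from (tree s) (n-leaves s) (distinct s) G i in
      trans (trans (Ψ-arc (tree s) (n-leaves s) (distinct s) G arc)
                   (sym (Ψ-arc (tree t) (n-leaves t) (distinct t) H arc)))
            (Ψ-to-correct t i)
      where
      G = proj₂ (greedy s)
      H = greedy-≅ G (relabel-≅ toℕ e)

    Ψ-to-injective : ∀ {s t} → (∀ i → mate (Ψ-to s) i ≡ mate (Ψ-to t) i) → tree s ≅ tree t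
    Ψ-to-injective {s} {t} eq = relabel-≅⁻ Fin.toℕ-injective (tree s) (tree t)
      -- Both runs are measured against `Ψ (tree s)`; the arcs of `t` obey it because the two
      -- matchings agree.
      (greedy-injective (Ψ (tree s)) (Ψ-arc (tree s) (n-leaves s) (distinct s) G) Ψ-arc′ fresh-s leaves↭ G H)
      where
      G = proj₂ (greedy s)
      H = proj₂ (greedy t)
      fresh-s = relabelled-fresh (tree s) (n-leaves s) (distinct s)
      Ψ-arc′ : ∀ {x y} → (x , y) ∈ arcs (proj₁ (greedy t)) → Ψ (tree s) x ≡ just y
      Ψ-arc′ arc =
        let i , _ , x≡i = ∈-map⁻ toℕ (∈-resp-↭ (ends↭ (tree t) (n-leaves t) (distinct t) H)
                          (arcs-ends {ps = proj₁ (greedy t)} arc))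
        in trans (cong (Ψ (tree s)) x≡i) (trans (Ψ-to-correct s i) (trans (cong (just ∘ toℕ) (eq i))
          (trans (sym (Ψ-to-correct t i)) (trans (cong (Ψ (tree t)) (sym x≡i))
            (Ψ-arc (tree t) (n-leaves t) (distinct t) H arc)))))
      leaves↭ : leaves (relabel toℕ (tree s)) ↭ leaves (relabel toℕ (tree t))
      leaves↭ = subst₂ _↭_ (sym (leaves-relabel toℕ (tree s))) (sym (leaves-relabel toℕ (tree t)))
        (map⁺-↭ toℕ (↭-trans (Unique⇒↭allFin (distinct s) (n-leaves s))
          (↭-sym (Unique⇒↭allFin (distinct t) (n-leaves t)))))

    Ψ-realises : {m : Fin N → Fin N} → IsMatching m →
                 ∃[ t ] ∃[ ps ] Greedy n (n ∸ 2) (relabel {Fin n} toℕ t) ps ×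
                   length (leaves t) ≡ n × Unique (leaves t) ×
                   (∀ {x y} → (x , y) ∈ arcs ps → extend m x ≡ y)
    Ψ-realises {m} isM
      with t , ps , G , leaves-t , arcs-t ← greedy-realises {m = extend m} (n ∸ 2) n (map toℕ (allFin n))
             (trans (length-toℕs n) n≡) (toℕs-fresh n)
             (pairing-resp-↭ (↭-sym (all-labels (toℕs-fresh n) (length-toℕs n))) (extend-pairing isM))
      with u , refl ← relabel-toℕ⁻ t (All-resp-↭ (↭-sym leaves-t) (Fresh.below (toℕs-fresh n))) =
      u , ps , G ,
      trans (sym (length-map toℕ (leaves u)))
        (trans (cong length (sym (leaves-relabel toℕ u))) (trans (↭-length leaves-t) (length-toℕs n))) ,
      Unique.map⁻ (subst Unique (leaves-relabel toℕ u) (Unique-resp-↭ (↭-sym leaves-t) (toℕs-unique n))) ,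
      arcs-t

    -- `Ψ-realises` disregards `k`; the number of single leaves follows afterwards from `Ψ-mixed`,
    -- read from right to left.
    Ψ-from : (M : Matching n k) → ∃[ t ] (∀ i → mate (Ψ-to t) i ≡ mate M i)
    Ψ-from M =
      let u , ps , G , len , uni , arcs-u = Ψ-realises (isMatching M)
          Ψm = λ i → let j , arc = arc-from u len uni G i in
                 trans (Ψ-arc u len uni G arc) (cong just (trans (sym (arcs-u arc)) (extend-toℕ (mate M) i)))
          t = record
            { tree     = u
            ; n-leaves = len
            ; distinct = uni
            ; k-single = trans (sym (Ψ-mixed u len uni G (mate M) Ψm)) (k-mixed M)
            }
      in t , Ψ-to-determined t (mate M) Ψm

    Ψ-bijection : Bijection (BinaryTrees n k) (Matchings n k)
    Ψ-bijection = record
      { to = Ψ-to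
      ; cong = λ {s} {t} → Ψ-to-cong {s} {t}
      ; bijective = (λ {s} {t} → Ψ-to-injective {s} {t}) ,
          λ M → let t , eq = Ψ-from M in t , λ {z} e i → trans (Ψ-to-cong {z} {t} e i) (eq i)
      }

theorem4 : (n k : ℕ) → 2 ≤ n →
    (Σ[ φ ∈ Bijection (MotzkinPaths n k) (BinaryTrees n k) ]
    (∀ w → Φ (MotzkinPath.word w) ≡ just (BinaryTree.tree (Bijection.to φ w))))
    ×
    (Σ[ ψ ∈ Bijection (BinaryTrees n k) (Matchings n k) ]
    (∀ t i → Ψ (BinaryTree.tree t) (toℕ i) ≡ just (toℕ (Matching.mate (Bijection.to ψ t) i))))
theorem4 n k 2≤n =
  (Φ-bijection n k 2≤n , Φ-to-correct n k 2≤n) ,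
  (Ψ-bijection n k 2≤n , Ψ-to-correct n k 2≤n)
  where
  open Φ-bijective using (Φ-bijection; Φ-to-correct)
  open Ψ-bijective using (Ψ-bijection; Ψ-to-correct)
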